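{- There is an algorithm which, given $k=5$ binary strings, each of length $\ell$, solves the Hamming string consensus problem for them in $O(\ell)$ time.
   Context: The (binary) Hamming string consensus problem, also called the closest string or center string problem: given binary strings $\mathbf{a}_1,\ldots,\mathbf{a}_k\in\{0,1\}^\ell$, find the minimum over $\mathbf{x}\in\{0,1\}^\ell$ of $\max_{1\le i\le k} d_H(\mathbf{x},\mathbf{a}_i)$, together with a string $\mathbf{x}$ attaining it, where $d_H$ is the Hamming distance (number of positions at which the two strings differ). Model of computation: $\ell$ fits in a machine word and arithmetic operations on integers of magnitude $O(\ell)$ take constant time. -}

module Defs where

open import Data.Bool using (Bool; true; false; if_then_else_)
import Data.Bool.Properties as Bool
open import Data.Fin using (Fin; toℕ)
open import Data.List using (List; []; _∷_)
open import Data.Nat using (ℕ; zero; suc; _+_; _*_; _∸_; _/_; _%_; _⊔_; _≤_; _<ᵇ_; _≡ᵇ_)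
open import Data.Product using (_×_; uncurry)
open import Data.Unit using (⊤)
open import Data.Vec using (Vec; map; zip; count; foldr′; concat; toList; lookup)
open import Relation.Binary.PropositionalEquality using (_≡_; _≢_)
open import Relation.Nullary.Decidable using (¬?)

------------------------------------------------------------------------
-- Hamming string consensus

BitString : ℕ → Set
BitString ℓ = Vec Bool ℓ

hamming : ∀ {ℓ} → BitString ℓ → BitString ℓ → ℕ
hamming x y = count (λ p → ¬? (uncurry Bool._≟_ p)) (zip x y)

maxDistance : ∀ {k ℓ} → BitString ℓ → Vec (BitString ℓ) k → ℕ
maxDistance x as = foldr′ _⊔_ 0 (map (hamming x) as)

-- d is the minimum over all strings of the maximal distance to the inputs,
-- and x attains it.
IsConsensus : ∀ {k ℓ} → Vec (BitString ℓ) k → ℕ → BitString ℓ → Set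
IsConsensus {ℓ = ℓ} as d x =
  maxDistance x as ≡ d × (∀ (y : BitString ℓ) → d ≤ maxDistance y as)

------------------------------------------------------------------------
-- Model of computation: a random access machine, programmed in structured
-- code, whose words are the natural numbers up to a bound W.  Every
-- elementary operation takes unit time.  A computation in which some value
-- (an address, a literal or an intermediate result) exceeds W is stuck.

data Op : Set where
  add sub mul div mod less equal : Op

-- A program mentions only finitely many registers, so naming them by ℕ
-- provides a constant number of registers per program; the memory is the
-- part that is addressed by computed values.
data Expr : Set where
  lit  : ℕ → Expr
  reg  : ℕ → Expr
  load : Expr → Expr
  op   : Op → Expr → Expr → Expr

infixr 5 _︔_

data Program : Set where
  skip  : Program
  _≔_   : ℕ → Expr → Program
  store : (address value : Expr) → Program
  _︔_   : Program → Program → Program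
  cond  : Expr → Program → Program → Program
  while : Expr → Program → Program

record State : Set where
  constructor state
  field
    register : ℕ → ℕ
    memory   : ℕ → ℕ
open State public

_[_↦_] : (ℕ → ℕ) → ℕ → ℕ → (ℕ → ℕ)
(f [ i ↦ v ]) j = if i ≡ᵇ j then v else f j

bit : Bool → ℕ
bit false = 0
bit true  = 1

-- Subtraction is truncated at 0; division and remainder by 0 yield 0.
applyOp : Op → ℕ → ℕ → ℕ
applyOp add   m n       = m + n
applyOp sub   m n       = m ∸ n
applyOp mul   m n       = m * n
applyOp div   m zero    = 0
applyOp div   m (suc n) = m / suc n
applyOp mod   m zero    = 0
applyOp mod   m (suc n) = m % suc n
applyOp less  m n       = bit (m <ᵇ n)
applyOp equal m n       = bit (m ≡ᵇ n)

eval : State → Expr → ℕ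
eval s (lit n)     = n
eval s (reg r)     = register s r
eval s (load e)    = memory s (eval s e)
eval s (op o e e′) = applyOp o (eval s e) (eval s e′)

-- Every value arising in the evaluation of the expression fits in a word.
Fits : ℕ → State → Expr → Set
Fits W s e = eval s e ≤ W × SubFits e
  where
  SubFits : Expr → Set
  SubFits (lit n)     = ⊤
  SubFits (reg r)     = ⊤
  SubFits (load e)    = Fits W s e
  SubFits (op o e e′) = Fits W s e × Fits W s e′

-- The time needed to evaluate an expression.
size : Expr → ℕ
size (lit n)     = 1
size (reg r)     = 1
size (load e)    = 1 + size e
size (op o e e′) = 1 + size e + size e′

-- Exec W p s t s′: on a machine with words up to W, the program p started in
-- state s halts in state s′ after t time units.  The rules are syntax-directed
-- and deterministic, so an inhabitant describes the only run of p from s.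
data Exec (W : ℕ) : Program → State → ℕ → State → Set where

  exec-skip : ∀ {s} → Exec W skip s 1 s

  exec-≔ : ∀ {s r e} → Fits W s e →
    Exec W (r ≔ e) s (1 + size e)
         (state (register s [ r ↦ eval s e ]) (memory s))

  exec-store : ∀ {s a e} → Fits W s a → Fits W s e →
    Exec W (store a e) s (1 + size a + size e)
         (state (register s) (memory s [ eval s a ↦ eval s e ]))

  exec-︔ : ∀ {p q s s′ s″ t t′} → Exec W p s t s′ → Exec W q s′ t′ s″ →
    Exec W (p ︔ q) s (t + t′) s″

  exec-cond-true : ∀ {e p q s s′ t} → Fits W s e → eval s e ≢ 0 →
    Exec W p s t s′ → Exec W (cond e p q) s (1 + size e + t) s′

  exec-cond-false : ∀ {e p q s s′ t} → Fits W s e → eval s e ≡ 0 →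
    Exec W q s t s′ → Exec W (cond e p q) s (1 + size e + t) s′

  exec-while-true : ∀ {e p s s′ s″ t t′} → Fits W s e → eval s e ≢ 0 →
    Exec W p s t s′ → Exec W (while e p) s′ t′ s″ →
    Exec W (while e p) s (1 + size e + t + t′) s″

  exec-while-false : ∀ {e p s} → Fits W s e → eval s e ≡ 0 →
    Exec W (while e p) s (1 + size e) s

------------------------------------------------------------------------
-- Input and output conventions

contents : List Bool → ℕ → ℕ
contents []       _       = 0
contents (b ∷ bs) zero    = bit b
contents (b ∷ bs) (suc n) = contents bs n

-- Register 0 holds ℓ, and symbol j of string i is stored at address i * ℓ + j;
-- everything else is 0.
input : ∀ {k ℓ} → Vec (BitString ℓ) k → State
input {ℓ = ℓ} as = state ((λ _ → 0) [ 0 ↦ ℓ ]) (contents (toList (concat as)))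

-- Register 0 holds d, and x is stored directly after the k input strings.
Output : ∀ {ℓ} → ℕ → State → ℕ → BitString ℓ → Set
Output {ℓ} k s d x =
  register s 0 ≡ d ×
  (∀ (j : Fin ℓ) → memory s (k * ℓ + toℕ j) ≡ bit (lookup x j))

{-# OPTIONS --safe #-}

-- The two symbols of x at a position whose column is a ∈ {0,1}ᵏ differ from
-- the inputs in the pattern a and in its complement.  Up to the order of the
-- positions, x is therefore a multiset of patterns, held in 2ᵏ counters.
--
-- Columns are added one at a time, keeping the multiset optimal.  A new column
-- raises each distance by at most one, so either the optimum goes up by one or
-- some other multiset keeps all distances within the old optimum.  In the second
-- case, the patterns that have to be complemented to reach that multiset act on
-- the distances as vectors of ±1.  They can be grouped into blocks of bounded
-- size such that in each coordinate no two blocks have opposite signs; hence a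
-- bounded number of complementations already suffices.  Trying all the finitely
-- many bounded moves after each column takes constant time, and a second pass
-- over the columns turns the counters into a string.

module Submission where

open import Defs
open import Data.Bool using (Bool; true; false; not; if_then_else_; T)
import Data.Bool.Properties as Bool
open import Data.Empty using (⊥-elim)
open import Data.Fin using (Fin; zero; suc; toℕ)
open import Data.Fin.Properties using (toℕ<n)
open import Data.List as List using (List; []; _∷_; _++_; allFin; concat; concatMap; length; map)
open import Data.List.Membership.Propositional using (_∈_; lose)
open import Data.List.Membership.Propositional.Properties
  using (∈-allFin; ∈-concatMap⁺; ∈-map⁺; ∈-++⁺ˡ; ∈-++⁺ʳ)
open import Data.List.Properties using (concat-++; length-++; map-++; map-∘; ++-assoc)
open import Data.List.Relation.Binary.Permutation.Propositional
  using (_↭_; prep; swap; ↭-refl; ↭-reflexive; ↭-sym; ↭-trans)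
open import Data.List.Relation.Binary.Permutation.Propositional.Properties
  using (map⁺; shift; shifts; ++⁺ˡ)
open import Data.List.Relation.Binary.Pointwise using (Pointwise; []; _∷_)
open import Data.List.Relation.Unary.All as All using (All; []; _∷_)
open import Data.List.Relation.Unary.All.Properties using () renaming (++⁺ to All-++⁺)
open import Data.List.Relation.Unary.Any using (here; there)
open import Data.Nat
open import Data.Nat.ListAction using (sum)
open import Data.Nat.ListAction.Properties using (sum-++; sum-↭)
open import Data.Nat.Properties
open import Data.Nat.Tactic.RingSolver using (solve-∀)
open import Data.Product using (∃-syntax; _×_; _,_; proj₁; proj₂)
open import Data.Sum using (_⊎_; inj₁; inj₂)
open import Data.Unit using (⊤; tt)
open import Data.Vec as Vec using (Vec; []; _∷_; lookup)
open import Data.Vec.Properties using (lookup-map; ≡-dec)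
open import Function using (_∘_)
open import Relation.Binary.Definitions using (DecidableEquality; tri<; tri≈; tri>)
open import Relation.Binary.PropositionalEquality
open import Relation.Nullary using (yes; no; does; ¬_)

-- Programs without loops and multiplication

infixl 6 _⊕_
infix  5 _≺_
infixr 5 _⨾_

data Term : Set where
  num     : ℕ → Term
  var     : ℕ → Term
  at      : Term → Term
  _⊕_ _≺_ : Term → Term → Term

data Code : Set where
  nop     : Code
  inc dec : ℕ → Code
  copy    : ℕ → ℕ → Code
  put     : Term → Bool → Code
  _⨾_     : Code → Code → Code
  branch  : Term → Code → Code → Code

⌜_⌝ : Term → Expr
⌜ num n ⌝ = lit n
⌜ var r ⌝ = reg r
⌜ at t  ⌝ = load ⌜ t ⌝
⌜ t ⊕ u ⌝ = op add ⌜ t ⌝ ⌜ u ⌝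
⌜ t ≺ u ⌝ = op less ⌜ t ⌝ ⌜ u ⌝

compile : Code → Program
compile nop            = skip
compile (inc r)        = r ≔ op add (reg r) (lit 1)
compile (dec r)        = r ≔ op sub (reg r) (lit 1)
compile (copy r q)     = r ≔ reg q
compile (put t b)      = store ⌜ t ⌝ (lit (bit b))
compile (c ⨾ c′)       = compile c ︔ compile c′
compile (branch t c c′) = cond ⌜ t ⌝ (compile c) (compile c′)

-- Follows the machine's zero test, so that `run` on a `branch` reduces once the guard is known to
-- be zero or a successor.
choose : {A : Set} → ℕ → A → A → A
choose zero    x y = y
choose (suc _) x y = x

⟦_⟧ : Term → State → ℕ
⟦ t ⟧ s = eval s ⌜ t ⌝

run : Code → State → State
run nop             s = s
run (inc r)         s = state (register s [ r ↦ register s r + 1 ]) (memory s)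
run (dec r)         s = state (register s [ r ↦ register s r ∸ 1 ]) (memory s)
run (copy r q)      s = state (register s [ r ↦ register s q ]) (memory s)
run (put t b)       s = state (register s) (memory s [ ⟦ t ⟧ s ↦ bit b ])
run (c ⨾ c′)        s = run c′ (run c s)
run (branch t c c′) s = choose (⟦ t ⟧ s) (run c s) (run c′ s)

-- Bounds at once the evaluation time, the values relative to the largest
-- value of the state and, for code, the growth of the largest value.
costᵗ : Term → ℕ
costᵗ (num n) = suc n
costᵗ (var r) = 1
costᵗ (at t)  = suc (costᵗ t)
costᵗ (t ⊕ u) = suc (costᵗ t + costᵗ u)
costᵗ (t ≺ u) = suc (costᵗ t + costᵗ u)

cost : Code → ℕ
cost nop             = 1
cost (inc r)         = 4
cost (dec r)         = 4
cost (copy r q)      = 2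
cost (put t b)       = suc (costᵗ t + 1)
cost (c ⨾ c′)        = cost c + cost c′
cost (branch t c c′) = suc (costᵗ t + (cost c + cost c′))

record Bounded (V : ℕ) (s : State) : Set where
  constructor bounded
  field
    registers : ∀ r → register s r ≤ V
    memories  : ∀ a → memory s a ≤ V
open Bounded

Bounded-mono : ∀ {V V′ s} → V ≤ V′ → Bounded V s → Bounded V′ s
Bounded-mono h (bounded u v) = bounded (λ r → ≤-trans (u r) h) (λ a → ≤-trans (v a) h)

bit≤1 : ∀ b → bit b ≤ 1
bit≤1 false = z≤n
bit≤1 true  = ≤-refl

size≤cost : ∀ t → size ⌜ t ⌝ ≤ costᵗ t
size≤cost (num n) = s≤s z≤n
size≤cost (var r) = ≤-refl
size≤cost (at t)  = s≤s (size≤cost t)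
size≤cost (t ⊕ u) = s≤s (+-mono-≤ (size≤cost t) (size≤cost u))
size≤cost (t ≺ u) = s≤s (+-mono-≤ (size≤cost t) (size≤cost u))

module _ {V s} (β : Bounded V s) (1≤V : 1 ≤ V) where

  private
    instance
      V≢0 : NonZero V
      V≢0 = >-nonZero 1≤V

  value≤ : ∀ t → ⟦ t ⟧ s ≤ costᵗ t * V
  value≤ (num n) = ≤-trans (n≤1+n n) (m≤m*n (suc n) V)
  value≤ (var r) = ≤-trans (registers β r) (m≤m+n V 0)
  value≤ (at t)  = ≤-trans (memories β _) (m≤m+n V _)
  value≤ (t ⊕ u) = begin
    ⟦ t ⟧ s + ⟦ u ⟧ s            ≤⟨ +-mono-≤ (value≤ t) (value≤ u) ⟩
    costᵗ t * V + costᵗ u * V    ≡⟨ *-distribʳ-+ V (costᵗ t) (costᵗ u) ⟨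
    (costᵗ t + costᵗ u) * V      ≤⟨ m≤n+m _ V ⟩
    costᵗ (t ⊕ u) * V            ∎
    where open ≤-Reasoning
  value≤ (t ≺ u) = ≤-trans (≤-trans (bit≤1 _) 1≤V) (m≤m+n V _)

  -- `costᵗ` of a subterm is at most that of the term, so a word bound that suffices for the term
  -- passes down to every value arising inside it.
  fits : ∀ t {W} → costᵗ t * V ≤ W → Fits W s ⌜ t ⌝
  fits (num n) h = ≤-trans (value≤ (num n)) h , tt
  fits (var r) h = ≤-trans (value≤ (var r)) h , tt
  fits (at t)  h = ≤-trans (value≤ (at t)) h , fits t (≤-trans (m≤n+m _ V) h)
  fits (t ⊕ u) h = ≤-trans (value≤ (t ⊕ u)) h ,
    fits t (≤-trans (*-monoˡ-≤ V (≤-trans (m≤m+n (costᵗ t) (costᵗ u)) (n≤1+n _))) h) ,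
    fits u (≤-trans (*-monoˡ-≤ V (≤-trans (m≤n+m _ (costᵗ t)) (n≤1+n _))) h)
  fits (t ≺ u) h = ≤-trans (value≤ (t ≺ u)) h ,
    fits t (≤-trans (*-monoˡ-≤ V (≤-trans (m≤m+n (costᵗ t) (costᵗ u)) (n≤1+n _))) h) ,
    fits u (≤-trans (*-monoˡ-≤ V (≤-trans (m≤n+m _ (costᵗ t)) (n≤1+n _))) h)

update≤ : ∀ {f : ℕ → ℕ} {V V′ i v} → (∀ j → f j ≤ V) → V ≤ V′ → v ≤ V′ → ∀ j → (f [ i ↦ v ]) j ≤ V′
update≤ {i = i} f≤ V≤ v≤ j with i ≡ᵇ j
... | true  = v≤
... | false = ≤-trans (f≤ j) V≤

run-bounded : ∀ c {V s} → Bounded V s → 1 ≤ V → Bounded (V + cost c) (run c s)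
run-bounded nop             β _ = Bounded-mono (m≤m+n _ _) β
run-bounded (inc r) {V}     β _ = bounded
  (update≤ {i = r} (registers β) (m≤m+n V 4) (+-mono-≤ (registers β r) (s≤s z≤n)))
  (λ a → ≤-trans (memories β a) (m≤m+n V 4))
run-bounded (dec r) {V}     β _ = bounded
  (update≤ {i = r} (registers β) (m≤m+n V 4) (≤-trans (m∸n≤m _ 1) (≤-trans (registers β r) (m≤m+n V 4))))
  (λ a → ≤-trans (memories β a) (m≤m+n V 4))
run-bounded (copy r q) {V}  β _ = bounded
  (update≤ {i = r} (registers β) (m≤m+n V 2) (≤-trans (registers β q) (m≤m+n V 2)))
  (λ a → ≤-trans (memories β a) (m≤m+n V 2))
run-bounded (put t b) {V} {s} β h = bounded
  (λ r → ≤-trans (registers β r) (m≤m+n V _))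
  (update≤ {i = ⟦ t ⟧ s} (memories β) (m≤m+n V _) (≤-trans (≤-trans (bit≤1 b) h) (m≤m+n V _)))
run-bounded (c ⨾ c′) {V}    β h = Bounded-mono (≤-reflexive (+-assoc V (cost c) (cost c′)))
  (run-bounded c′ (run-bounded c β h) (≤-trans h (m≤m+n V _)))
run-bounded (branch t c c′) {V} {s} β h with ⟦ t ⟧ s
... | zero  = Bounded-mono
  (+-monoʳ-≤ V (≤-trans (m≤n+m _ (cost c)) (≤-trans (m≤n+m _ (costᵗ t)) (n≤1+n _))))
  (run-bounded c′ β h)
... | suc _ = Bounded-mono
  (+-monoʳ-≤ V (≤-trans (m≤m+n _ (cost c′)) (≤-trans (m≤n+m _ (costᵗ t)) (n≤1+n _))))
  (run-bounded c β h)

private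
  need-mono : ∀ {m m′ V V′} {W} → m ≤ m′ → V ≤ V′ → m′ * V′ ≤ W → m * V ≤ W
  need-mono p q = ≤-trans (*-mono-≤ p q)

-- No state during the run holds a value above `V + cost c`, and evaluating a term multiplies the
-- largest value at most by the cost of the term; the product covers all intermediate values.
exec-run : ∀ c {V W s} → Bounded V s → 1 ≤ V → cost c * (V + cost c) ≤ W →
  ∃[ t ] (Exec W (compile c) s t (run c s) × t ≤ cost c)
exec-run nop β h w = 1 , exec-skip , ≤-refl
exec-run (inc r) {V} {W} {s} β h w = _ , exec-≔ (x+1 , (x , tt) , (≤-trans (m≤n+m 1 _) x+1 , tt)) , ≤-refl
  where
  x+1 : register s r + 1 ≤ W
  x+1 = ≤-trans (+-mono-≤ (registers β r) (s≤s {n = 3} z≤n)) (≤-trans (m≤m+n _ _) w)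
  x : register s r ≤ W
  x = ≤-trans (m≤m+n _ 1) x+1
exec-run (dec r) {V} {W} {s} β h w =
  _ , exec-≔ (≤-trans (m∸n≤m _ 1) x , (x , tt) , (≤-trans h V≤W , tt)) , ≤-refl
  where
  V≤W : V ≤ W
  V≤W = ≤-trans (m≤m+n V 4) (≤-trans (m≤m+n _ _) w)
  x : register s r ≤ W
  x = ≤-trans (registers β r) V≤W
exec-run (copy r q) {V} β h w =
  _ , exec-≔ (≤-trans (registers β q) (≤-trans (m≤m+n V 2) (≤-trans (m≤m+n _ _) w)) , tt) , ≤-refl
exec-run (put t b) {V} {W} β h w =
  _ , exec-store (fits β h t (need-mono (≤-trans (m≤m+n (costᵗ t) 1) (n≤1+n _)) (m≤m+n V _) w))
        (≤-trans (≤-trans (bit≤1 b) h) (≤-trans (m≤m+n V _) (≤-trans (m≤m+n _ _) w)) , tt) ,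
  s≤s (+-monoˡ-≤ 1 (size≤cost t))
exec-run (c ⨾ c′) {V} β h w
  with exec-run c β h (need-mono (m≤m+n (cost c) (cost c′)) (+-monoʳ-≤ V (m≤m+n _ _)) w)
     | exec-run c′ (run-bounded c β h) (≤-trans h (m≤m+n V _))
         (need-mono (m≤n+m (cost c′) (cost c)) (≤-reflexive (+-assoc V _ _)) w)
... | t , x , b | t′ , x′ , b′ = t + t′ , exec-︔ x x′ , +-mono-≤ b b′
exec-run (branch t c c′) {V} {W} {s} β h w with ⟦ t ⟧ s in eq
... | zero  =
  let c≤ = ≤-trans (m≤n+m (cost c′) (cost c)) (≤-trans (m≤n+m _ (costᵗ t)) (n≤1+n _))
      u , x , b = exec-run c′ β h (need-mono c≤ (+-monoʳ-≤ V c≤) w)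
  in _ , exec-cond-false (fits β h t (need-mono t≤ (m≤m+n V _) w)) eq x ,
     s≤s (+-mono-≤ (size≤cost t) (≤-trans b (m≤n+m _ (cost c))))
  where
  t≤ : costᵗ t ≤ cost (branch t c c′)
  t≤ = ≤-trans (m≤m+n _ (cost c + cost c′)) (n≤1+n _)
... | suc _ =
  let c≤ = ≤-trans (m≤m+n (cost c) (cost c′)) (≤-trans (m≤n+m _ (costᵗ t)) (n≤1+n _))
      u , x , b = exec-run c β h (need-mono c≤ (+-monoʳ-≤ V c≤) w)
  in _ , exec-cond-true (fits β h t (need-mono t≤ (m≤m+n V _) w)) (λ e → 1+n≢0 (trans (sym eq) e)) x ,
     s≤s (+-mono-≤ (size≤cost t) (≤-trans b (m≤m+n _ (cost c′))))
  where
  t≤ : costᵗ t ≤ cost (branch t c c′)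
  t≤ = ≤-trans (m≤m+n _ (cost c + cost c′)) (n≤1+n _)

-- Loops with a constant budget per iteration

data Runs (g : Term) (c : Code) : ℕ → State → State → Set where
  stop : ∀ {s} → ⟦ g ⟧ s ≡ 0 → Runs g c 0 s s
  step : ∀ {n s s′} → ⟦ g ⟧ s ≢ 0 → Runs g c n (run c s) s′ → Runs g c (suc n) s s′

Runs-bounded : ∀ {g c n s s′ V K} → Runs g c n s s′ → cost c ≤ K → Bounded V s → 1 ≤ V →
  Bounded (V + n * K) s′
Runs-bounded {V = V} (stop _) _ β _ = Bounded-mono (m≤m+n V 0) β
Runs-bounded {c = c} {V = V} {K} (step {n} _ r) k β h =
  Bounded-mono (≤-reflexive (+-assoc V K (n * K)))
    (Runs-bounded r k (Bounded-mono (+-monoʳ-≤ V k) (run-bounded c β h)) (≤-trans h (m≤m+n V K)))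

-- `K` pays for one test of the guard and one run of the body, both in time and in growth of the
-- largest value. The extra unit in `suc n` pays for the final, failing test.
exec-while : ∀ {g c n s s′ V W K} → Runs g c n s s′ → suc (costᵗ g + cost c) ≤ K →
  Bounded V s → 1 ≤ V → K * (V + suc n * K) ≤ W →
  ∃[ t ] (Exec W (while ⌜ g ⌝ (compile c)) s t s′ × t ≤ suc n * K)
exec-while {g} {c} {V = V} {K = K} (stop e) k β h w = _ ,
  exec-while-false (fits β h g (need-mono (≤-trans (m≤m+n _ (cost c)) (≤-trans (n≤1+n _) k)) (m≤m+n V _) w)) e ,
  ≤-trans (s≤s (size≤cost g)) (≤-trans (≤-trans (s≤s (m≤m+n (costᵗ g) (cost c))) k) (m≤m+n K 0))
exec-while {g} {c} {V = V} {K = K} (step {n} e r) k β h w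
  with exec-run c β h (need-mono c≤K (+-monoʳ-≤ V (≤-trans c≤K (m≤m+n K _))) w)
     | exec-while r k (Bounded-mono (+-monoʳ-≤ V c≤K) (run-bounded c β h)) (≤-trans h (m≤m+n V K))
         (need-mono {K} ≤-refl (≤-reflexive (+-assoc V K _)) w)
  where
  c≤K : cost c ≤ K
  c≤K = ≤-trans (m≤n+m (cost c) (costᵗ g)) (≤-trans (n≤1+n _) k)
... | t , x , b | t′ , x′ , b′ = _ ,
  exec-while-true (fits β h g (need-mono (≤-trans (m≤m+n _ (cost c)) (≤-trans (n≤1+n _) k)) (m≤m+n V _) w)) e x x′ ,
  +-mono-≤ (≤-trans (s≤s (+-mono-≤ (size≤cost g) b)) k) b′

-- Grouping into blocks without opposite signs

module _ {A : Set} where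

  tally : (A → Bool) → List A → ℕ
  tally f xs = sum (map (bit ∘ f) xs)

  tally-++ : ∀ f xs ys → tally f (xs ++ ys) ≡ tally f xs + tally f ys
  tally-++ f xs ys = trans (cong sum (map-++ _ xs ys)) (sum-++ (map _ xs) _)

  tally-↭ : ∀ f {xs ys} → xs ↭ ys → tally f xs ≡ tally f ys
  tally-↭ f = sum-↭ ∘ map⁺ _

  tally≤length : ∀ f xs → tally f xs ≤ length xs
  tally≤length f []       = z≤n
  tally≤length f (x ∷ xs) = +-mono-≤ (bit≤1 (f x)) (tally≤length f xs)

  tally-++-≤ : ∀ f g x y {n} → tally f x + tally f y ≤ tally g x + tally g y + n →
    tally f (x ++ y) ≤ tally g (x ++ y) + n
  tally-++-≤ f g x y = subst₂ _≤_ (sym (tally-++ f x y)) (cong (_+ _) (sym (tally-++ g x y)))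

  tally-concat-≤ : ∀ f g {R} → All (λ b → tally f b ≤ tally g b) R →
    tally f (concat R) ≤ tally g (concat R)
  tally-concat-≤ f g []             = z≤n
  tally-concat-≤ f g (_∷_ {b} {R} p ps) = begin
    tally f (b ++ concat R)         ≡⟨ tally-++ f b _ ⟩
    tally f b + tally f (concat R)  ≤⟨ +-mono-≤ p (tally-concat-≤ f g ps) ⟩
    tally g b + tally g (concat R)  ≡⟨ tally-++ g b _ ⟨
    tally g (b ++ concat R)         ∎
    where open ≤-Reasoning

  -- `m` is a base and `R` a list of blocks. Merging blocks with each other or into the base is
  -- recorded by what it preserves: the total multiset, and all properties stable under such
  -- mergers.
  record Coarsens (m : List A) (R : List (List A)) (m′ : List A) (R′ : List (List A)) : Set₁ where
    field
      perm : m′ ++ concat R′ ↭ m ++ concat R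
      keep : ∀ (F G : List A → Set) →
        (∀ {x y} → F x → G y → F (x ++ y)) → (∀ {x y} → G x → G y → G (x ++ y)) →
        F m → All G R → F m′ × All G R′
  open Coarsens

  Coarsens-refl : ∀ {m R} → Coarsens m R m R
  Coarsens-refl .perm             = ↭-refl
  Coarsens-refl .keep F G _ _ p q = p , q

  Coarsens-trans : ∀ {m R m′ R′ m″ R″} →
    Coarsens m R m′ R′ → Coarsens m′ R′ m″ R″ → Coarsens m R m″ R″
  Coarsens-trans c c′ .perm = ↭-trans (perm c′) (perm c)
  Coarsens-trans c c′ .keep F G u v p q = let p′ , q′ = keep c F G u v p q in keep c′ F G u v p′ q′

  Keeps : (R P L : List (List A)) → Set₁
  Keeps R P L = ∀ (G : List A → Set) → (∀ {x y} → G x → G y → G (x ++ y)) →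
    All G R → All G P × All G L

  -- Pairing blocks of opposite sign in one coordinate

  module _ (f g : A → Bool) where

    private
      up dn : List A → ℕ
      up = tally f
      dn = tally g

    -- The net change of the coordinate lies between `-n` and `p`, written without subtraction.
    record Bounds (n p S : ℕ) (b : List A) : Set where
      constructor bounds
      field
        lower : dn b ≤ up b + n
        upper : up b ≤ dn b + p
        short : length b ≤ S

    Bounds-mono : ∀ {n n′ p p′ S S′ b} → n ≤ n′ → p ≤ p′ → S ≤ S′ →
      Bounds n p S b → Bounds n′ p′ S′ b
    Bounds-mono {b = b} n≤ p≤ S≤ (bounds l u s) =
      bounds (≤-trans l (+-monoʳ-≤ (up b) n≤)) (≤-trans u (+-monoʳ-≤ (dn b) p≤)) (≤-trans s S≤)

    private
      shave : ∀ {a b c d n} → a ≤ b + suc n → suc c ≤ d → a + c ≤ (b + d) + n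
      shave {a} {b} {c} {d} {n} p q = +-cancelˡ-≤ 1 _ _ (begin
        1 + (a + c)        ≡⟨ +-suc a c ⟨
        a + suc c          ≤⟨ +-mono-≤ p q ⟩
        b + suc n + d      ≡⟨ lemma b n d ⟩
        1 + (b + d + n)    ∎)
        where
        open ≤-Reasoning
        lemma : ∀ b n d → b + suc n + d ≡ 1 + (b + d + n)
        lemma = solve-∀

    -- A value in `1..p+1` plus a value in `-(n+1)..-1` lies in `-n..p`, so both ends of the
    -- interval move in by one.
    join : ∀ {n p S x y} → Bounds (suc n) (suc p) S x → Bounds (suc n) (suc p) S y →
      dn x < up x → up y < dn y → Bounds n p (S + S) (x ++ y)
    join {n} {p} {S} {x} {y} (bounds lx ux sx) (bounds ly uy sy) x⁺ y⁻ =
      bounds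
        (tally-++-≤ g f x y (subst₂ _≤_ (+-comm (dn y) _) (cong (_+ n) (+-comm (up y) _)) (shave ly x⁺)))
        (tally-++-≤ f g x y (shave ux y⁻))
        (≤-trans (≤-reflexive (length-++ x)) (+-mono-≤ sx sy))

    join′ : ∀ {n p S x y} → Bounds (suc n) (suc p) S x → Bounds (suc n) (suc p) S y →
      up x < dn x → dn y < up y → Bounds n p (S + S) (x ++ y)
    join′ {n} {p} {S} {x} {y} (bounds lx ux sx) (bounds ly uy sy) x⁻ y⁺ =
      bounds
        (tally-++-≤ g f x y (shave lx y⁺))
        (tally-++-≤ f g x y (subst₂ _≤_ (+-comm (up y) _) (cong (_+ p) (+-comm (dn y) _)) (shave uy x⁻)))
        (≤-trans (≤-reflexive (length-++ x)) (+-mono-≤ sx sy))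

    record Pairing (n p S : ℕ) (R : List (List A)) : Set₁ where
      constructor pairing
      field
        {paired rest} : List (List A)
        perm : concat paired ++ concat rest ↭ concat R
        keep : Keeps R paired rest
        paired-bounds : All (Bounds n p (S + S)) paired
        rest-bounds   : All (Bounds (suc n) (suc p) S) rest
        rest-sign     : All (λ b → dn b < up b) rest ⊎ All (λ b → up b < dn b) rest

    -- Greedy matching: `rest` has a single sign at all times, and a new block either shares it and
    -- is set aside or is merged with the head of `rest`. A block of net change zero meets the
    -- tighter bounds by itself and counts as paired.
    pair : ∀ {n p S R} → All (Bounds (suc n) (suc p) S) R → Pairing n p S R
    pair [] = pairing ↭-refl (λ _ _ _ → [] , []) [] [] (inj₁ [])
    pair {n} {p} {S} (_∷_ {b} {R} β βs) with pair βs
    ... | pairing {P} {L} ↭R kp pb rb sg = go (<-cmp (up b) (dn b)) L ↭R kp rb sg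
      where
      set-aside : ∀ {L} → concat P ++ concat L ↭ concat R →
        concat P ++ (b ++ concat L) ↭ b ++ concat R
      set-aside {L} q = ↭-trans (shifts (concat P) b) (++⁺ˡ b q)

      merge : ∀ {l L} → concat P ++ (l ++ concat L) ↭ concat R →
        ((b ++ l) ++ concat P) ++ concat L ↭ b ++ concat R
      merge {l} {L} q = ↭-trans
        (↭-reflexive (trans (++-assoc (b ++ l) (concat P) _) (++-assoc b l _)))
        (++⁺ˡ b (↭-trans (shifts l (concat P)) q))

      go : _ → ∀ L → concat P ++ concat L ↭ concat R → Keeps R P L →
        All (Bounds (suc n) (suc p) S) L →
        All (λ b → dn b < up b) L ⊎ All (λ b → up b < dn b) L →
        Pairing n p S (b ∷ R)
      go (tri≈ _ e _) L q kp rb sg = pairing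
        (↭-trans (↭-reflexive (++-assoc b _ _)) (++⁺ˡ b q))
        (λ { G c (h ∷ hs) → let u , v = kp G c hs in h ∷ u , v })
        (bounds (≤-trans (≤-reflexive (sym e)) (m≤m+n _ n)) (≤-trans (≤-reflexive e) (m≤m+n _ p))
                (≤-trans (Bounds.short β) (m≤m+n S S)) ∷ pb)
        rb sg
      go (tri< b⁻ _ _) [] q kp rb sg = pairing (set-aside {[]} q)
        (λ { G c (h ∷ hs) → proj₁ (kp G c hs) , h ∷ [] }) pb (β ∷ []) (inj₂ (b⁻ ∷ []))
      go (tri< b⁻ _ _) (l ∷ L) q kp rb (inj₂ sg) = pairing (set-aside {l ∷ L} q)
        (λ { G c (h ∷ hs) → let u , v = kp G c hs in u , h ∷ v }) pb (β ∷ rb) (inj₂ (b⁻ ∷ sg))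
      go (tri< b⁻ _ _) (l ∷ L) q kp (λb ∷ rb) (inj₁ (l⁺ ∷ sg)) = pairing (merge {l} {L} q)
        (λ { G c (h ∷ hs) → let u , v = kp G c hs in c h (All.head v) ∷ u , All.tail v })
        (join′ β λb b⁻ l⁺ ∷ pb) rb (inj₁ sg)
      go (tri> _ _ b⁺) [] q kp rb sg = pairing (set-aside {[]} q)
        (λ { G c (h ∷ hs) → proj₁ (kp G c hs) , h ∷ [] }) pb (β ∷ []) (inj₁ (b⁺ ∷ []))
      go (tri> _ _ b⁺) (l ∷ L) q kp rb (inj₁ sg) = pairing (set-aside {l ∷ L} q)
        (λ { G c (h ∷ hs) → let u , v = kp G c hs in u , h ∷ v }) pb (β ∷ rb) (inj₁ (b⁺ ∷ sg))
      go (tri> _ _ b⁺) (l ∷ L) q kp (λb ∷ rb) (inj₂ (l⁻ ∷ sg)) = pairing (merge {l} {L} q)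
        (λ { G c (h ∷ hs) → let u , v = kp G c hs in c h (All.head v) ∷ u , All.tail v })
        (join β λb b⁺ l⁻ ∷ pb) rb (inj₂ sg)

  -- This is `S * 2 ^ t`, the size bound after `t` rounds of merging two at a time.
  doubled : ℕ → ℕ → ℕ
  doubled zero    S = S
  doubled (suc t) S = doubled t (S + S)

  doubled-≥ : ∀ t S → S ≤ doubled t S
  doubled-≥ zero    S = ≤-refl
  doubled-≥ (suc t) S = ≤-trans (m≤m+n S S) (doubled-≥ t (S + S))

  -- Applying x to the distances D raises D i by one if f i x, and lowers it by
  -- one if g i x.  Both sides of the inequalities are sums to avoid subtraction.
  module _ {I : Set} (f g : I → A → Bool) (D : I → ℕ) (d : ℕ) where

    -- `p` is the excess over `d` allowed in coordinate `i` once `m` has been applied.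
    Base : I → ℕ → List A → Set
    Base i p m = D i + tally (f i) m ≤ d + tally (g i) m + p

    -- Either the base alone respects `d` and no block does harm, or no block helps. Both
    -- alternatives survive further merging, so the coordinates can be treated one after another.
    Conformal : I → List A → List (List A) → Set
    Conformal i m R =
      (Base i 0 m × All (λ b → tally (f i) b ≤ tally (g i) b) R) ⊎
      All (λ b → tally (g i) b ≤ tally (f i) b) R

    -- A block that lowers the coordinate by `q` uses up `q` of the allowed excess. The case `q = 0`
    -- serves `conformal-keep`; the case `q = 1` makes the progress in `refine`.
    Base-absorb : ∀ {i p q m b} → Base i (q + p) m → tally (f i) b + q ≤ tally (g i) b →
      Base i p (m ++ b)
    Base-absorb {i} {p} {q} {m} {b} β h = +-cancelˡ-≤ q _ _ (begin
        q + (D i + tally (f i) (m ++ b))               ≡⟨ cong (λ t → q + (D i + t)) (tally-++ (f i) m b) ⟩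
        q + (D i + (tally (f i) m + tally (f i) b))    ≡⟨ l₁ q (D i) _ _ ⟩
        D i + tally (f i) m + (tally (f i) b + q)      ≤⟨ +-mono-≤ β h ⟩
        d + tally (g i) m + (q + p) + tally (g i) b    ≡⟨ l₂ d _ q p _ ⟩
        q + (d + (tally (g i) m + tally (g i) b) + p)  ≡⟨ cong (λ t → q + (d + t + p)) (tally-++ (g i) m b) ⟨
        q + (d + tally (g i) (m ++ b) + p)             ∎)
      where
      open ≤-Reasoning
      l₁ : ∀ q D a b → q + (D + (a + b)) ≡ D + a + (b + q)
      l₁ = solve-∀
      l₂ : ∀ d a q p b → d + a + (q + p) + b ≡ q + (d + (a + b) + p)
      l₂ = solve-∀

    conformal-keep : ∀ {i m R m′ R′} → Coarsens m R m′ R′ → Conformal i m R → Conformal i m′ R′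
    conformal-keep {i} c (inj₁ (β , ns)) = inj₁ (keep c (Base i 0) _
      (λ {x} {y} u v → Base-absorb {i} {0} {0} {x} {y} u (≤-trans (≤-reflexive (+-identityʳ _)) v))
      (λ {x} {y} u v → subst₂ _≤_ (sym (tally-++ (f i) x y)) (sym (tally-++ (g i) x y)) (+-mono-≤ u v))
      β ns)
    conformal-keep {i} c (inj₂ ps) = inj₂ (proj₂ (keep c (λ _ → ⊤) _ _
      (λ {x} {y} u v → subst₂ _≤_ (sym (tally-++ (g i) x y)) (sym (tally-++ (f i) x y)) (+-mono-≤ u v))
      tt ps))

    record Refined (T : ℕ) (is : List I) (m : List A) (R : List (List A)) : Set₁ where
      constructor refined
      field
        {m′}      : List A
        {R′}      : List (List A)
        coarsens  : Coarsens m R m′ R′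
        base-size : length m′ ≤ T
        sizes     : All (λ b → length b ≤ T) R′
        conformal : All (λ i → Conformal i m′ R′) is

    Refined-trans : ∀ {T is m R m₁ R₁} → Coarsens m R m₁ R₁ → Refined T is m₁ R₁ → Refined T is m R
    Refined-trans c (refined c′ u v w) = refined (Coarsens-trans c c′) u v w

    -- Pairs of blocks of opposite sign satisfy both bounds with one to spare, and
    -- the blocks left over, all of the same sign, satisfy one of them trivially.
    refine : ∀ i n p S {m R} → length m ≤ S → Base i p m → All (Bounds (f i) (g i) n p S) R →
      Refined (doubled (n + p) S) (i ∷ []) m R
    refine i n zero S sz β bs = refined Coarsens-refl
      (≤-trans sz (doubled-≥ (n + 0) S))
      (All.map (λ b → ≤-trans (Bounds.short b) (doubled-≥ (n + 0) S)) bs)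
      (inj₁ (β , All.map (λ b → ≤-trans (Bounds.upper b) (≤-reflexive (+-identityʳ _))) bs) ∷ [])
    refine i zero (suc p) S sz β bs = refined Coarsens-refl
      (≤-trans sz (doubled-≥ (suc p) S))
      (All.map (λ b → ≤-trans (Bounds.short b) (doubled-≥ (suc p) S)) bs)
      (inj₂ (All.map (λ b → ≤-trans (Bounds.lower b) (≤-reflexive (+-identityʳ _))) bs) ∷ [])
    refine i (suc n) (suc p) S {m} {R} sz β bs with pair (f i) (g i) bs
    ... | pairing {P} {L} ↭R kp pb rb sg = go L ↭R kp rb sg
      where
      S≤ = m≤m+n S S

      -- The leftover blocks do not lower the coordinate and the paired ones lower it by at most
      -- `n`, so the induction proceeds with `n` in place of `suc n`.
      no-down : ∀ L → concat P ++ concat L ↭ concat R → Keeps R P L →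
        All (Bounds (f i) (g i) (suc n) (suc p) S) L →
        All (λ b → tally (g i) b ≤ tally (f i) b) L → Refined (doubled (suc n + suc p) S) (i ∷ []) m R
      no-down L ↭R kp rb sg = Refined-trans
        (record
          { perm = ++⁺ˡ m (↭-trans (↭-reflexive (sym (concat-++ P L))) ↭R)
          ; keep = λ F G _ c u v → let a , b = kp G c v in u , All-++⁺ a b })
        (refine i n (suc p) (S + S) (≤-trans sz S≤) β (All-++⁺
          (All.map (Bounds-mono (f i) (g i) ≤-refl (n≤1+n p) ≤-refl) pb)
          (All.zipWith (λ { (bounds _ u s , h) → bounds (≤-trans h (m≤m+n _ n)) u (≤-trans s S≤) })
            (rb , sg))))

      go : ∀ L → concat P ++ concat L ↭ concat R → Keeps R P L →
        All (Bounds (f i) (g i) (suc n) (suc p) S) L →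
        All (λ b → tally (g i) b < tally (f i) b) L ⊎ All (λ b → tally (f i) b < tally (g i) b) L →
        Refined (doubled (suc n + suc p) S) (i ∷ []) m R
      go L  q kp rb (inj₁ sg) = no-down L q kp rb (All.map <⇒≤ sg)
      go [] q kp rb (inj₂ sg) = no-down [] q kp rb []
      -- All leftover blocks lower the coordinate. Absorbing one of them into the base reduces its
      -- excess by one, which is what permits `p` in place of `suc p`.
      go (l ∷ L) q kp (λb ∷ rb) (inj₂ (l⁻ ∷ sg)) rewrite +-suc n p = Refined-trans
        (record
          { perm = ↭-trans (↭-reflexive (++-assoc m l _)) (++⁺ˡ m
              (↭-trans (++⁺ˡ l (↭-reflexive (sym (concat-++ P L)))) (↭-trans (shifts l (concat P)) q)))
          ; keep = λ F G h c u v → let a , b = kp G c v in h u (All.head b) , All-++⁺ a (All.tail b) })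
        (refine i (suc n) p (S + S)
          (≤-trans (≤-reflexive (length-++ m)) (+-mono-≤ sz (Bounds.short λb)))
          (Base-absorb {i} {p} {1} {m} {l} β (≤-trans (≤-reflexive (+-comm _ 1)) l⁻))
          (All-++⁺
            (All.map (Bounds-mono (f i) (g i) (n≤1+n n) ≤-refl ≤-refl) pb)
            (All.zipWith (λ { (bounds u _ s , h) → bounds u (≤-trans (<⇒≤ h) (m≤m+n _ p)) (≤-trans s S≤) })
              (rb , sg))))

  -- Blocks of length at most `S` change a coordinate by at most `S`, and the base exceeds `d` by at
  -- most `suc S`, so `refine` needs `S + suc S` doublings per coordinate. The result is independent
  -- of the number of blocks.
  blockSize : {I : Set} → List I → ℕ → ℕ
  blockSize []       S = S
  blockSize (i ∷ is) S = blockSize is (doubled (S + suc S) S)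

  module _ {I : Set} (f g : I → A → Bool) (D : I → ℕ) (d : ℕ) (D≤ : ∀ i → D i ≤ suc d) where

    refineAll : ∀ is S {m R} → length m ≤ S → All (λ b → length b ≤ S) R →
      Refined f g D d (blockSize is S) is m R
    refineAll []       S sz szs = refined Coarsens-refl sz szs []
    refineAll (i ∷ is) S {m} sz szs
      with refine f g D d i S (suc S) S sz base (All.map bnd szs)
      where
      bnd : ∀ {b} → length b ≤ S → Bounds (f i) (g i) S (suc S) S b
      bnd {b} h = bounds (≤-trans (tally≤length (g i) b) (≤-trans h (m≤n+m S _)))
        (≤-trans (tally≤length (f i) b) (≤-trans h (≤-trans (n≤1+n S) (m≤n+m (suc S) _)))) h
      -- One unit of excess comes from `D≤`, the other `S` from the elements of `m`.
      base : Base f g D d i (suc S) m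
      base = begin
        D i + tally (f i) m            ≤⟨ +-mono-≤ (D≤ i) (≤-trans (tally≤length (f i) m) sz) ⟩
        suc d + S                      ≡⟨ +-suc d S ⟨
        d + suc S                      ≤⟨ +-monoˡ-≤ (suc S) (m≤m+n d _) ⟩
        d + tally (g i) m + suc S      ∎
        where open ≤-Reasoning
    ... | refined c sz₁ szs₁ (cf ∷ []) with refineAll is _ sz₁ szs₁
    ... | refined c′ sz₂ szs₂ cfs = refined (Coarsens-trans c c′) sz₂ szs₂
      (conformal-keep f g D d c′ cf ∷ cfs)

    -- If no block lowers coordinate i, then omitting blocks cannot raise it, so
    -- the base inherits the bound of the total.
    bounded-exchange : ∀ is δ → (∀ i → D i + tally (f i) δ ≤ d + tally (g i) δ) →
      ∃[ m ] ∃[ r ] (m ++ r ↭ δ × length m ≤ blockSize is 1 ×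
        All (λ i → D i + tally (f i) m ≤ d + tally (g i) m) is)
    bounded-exchange is δ total
      with refineAll is 1 {[]} {map List.[_] δ} z≤n (singletons δ)
      where
      singletons : ∀ δ → All (λ b → length b ≤ 1) (map List.[_] δ)
      singletons []      = []
      singletons (_ ∷ δ) = s≤s z≤n ∷ singletons δ
    ... | refined {m} {R} c sz _ cfs = m , concat R , ↭δ , sz , All.map concl cfs
      where
      open ≤-Reasoning
      concat-singletons : ∀ (δ : List A) → concat (map List.[_] δ) ≡ δ
      concat-singletons []      = refl
      concat-singletons (x ∷ δ) = cong (x ∷_) (concat-singletons δ)
      ↭δ : m ++ concat R ↭ δ
      ↭δ = ↭-trans (perm c) (↭-reflexive (concat-singletons δ))
      concl : ∀ {i} → Conformal f g D d i m R → D i + tally (f i) m ≤ d + tally (g i) m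
      concl {i} (inj₁ (β , _)) = ≤-trans β (≤-reflexive (+-identityʳ _))
      concl {i} (inj₂ ps) = +-cancelʳ-≤ (tally (f i) (concat R)) _ _ (begin
        D i + tally (f i) m + tally (f i) (concat R)    ≡⟨ +-assoc (D i) _ _ ⟩
        D i + (tally (f i) m + tally (f i) (concat R))  ≡⟨ cong (D i +_) (split (f i)) ⟨
        D i + tally (f i) δ                             ≤⟨ total i ⟩
        d + tally (g i) δ                               ≡⟨ cong (d +_) (split (g i)) ⟩
        d + (tally (g i) m + tally (g i) (concat R))    ≡⟨ +-assoc d _ _ ⟨
        d + tally (g i) m + tally (g i) (concat R)      ≤⟨ +-monoʳ-≤ _ (tally-concat-≤ (g i) (f i) ps) ⟩
        d + tally (g i) m + tally (f i) (concat R)      ∎)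
        where
        split : ∀ h → tally h δ ≡ tally h m + tally h (concat R)
        split h = trans (tally-↭ h (↭-sym ↭δ)) (tally-++ h m (concat R))

-- Patterns and moves

infix 4 _≟ᵇ_
_≟ᵇ_ : ∀ {k} → DecidableEquality (BitString k)
_≟ᵇ_ = ≡-dec Bool._≟_

complement : ∀ {k} → BitString k → BitString k
complement = Vec.map not

complement-involutive : ∀ {k} (w : BitString k) → complement (complement w) ≡ w
complement-involutive []      = refl
complement-involutive (b ∷ w) = cong₂ _∷_ (Bool.not-involutive b) (complement-involutive w)

patterns : ∀ k → List (BitString k)
patterns zero    = [] ∷ []
patterns (suc k) = map (false ∷_) (patterns k) ++ map (true ∷_) (patterns k)

∈-patterns : ∀ {k} (w : BitString k) → w ∈ patterns k
∈-patterns []          = here refl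
∈-patterns (false ∷ w) = ∈-++⁺ˡ (∈-map⁺ (false ∷_) (∈-patterns w))
∈-patterns (true ∷ w)  = ∈-++⁺ʳ _ (∈-map⁺ (true ∷_) (∈-patterns w))

words : {A : Set} → List A → ℕ → List (List A)
words xs zero    = [] ∷ []
words xs (suc n) = [] ∷ concatMap (λ x → map (x ∷_) (words xs n)) xs

∈-words : {A : Set} {xs : List A} → (∀ x → x ∈ xs) → ∀ {n} m → length m ≤ n → m ∈ words xs n
∈-words xs∋ {zero}  []      _       = here refl
∈-words xs∋ {suc n} []      _       = here refl
∈-words xs∋ {suc n} (x ∷ m) (s≤s h) = there
  (∈-concatMap⁺ (λ x → map (x ∷_) (words _ n)) (lose (xs∋ x) (∈-map⁺ (x ∷_) (∈-words xs∋ m h))))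

code : ∀ {k} → BitString k → ℕ
code []          = 0
code (false ∷ w) = 2 * code w
code (true ∷ w)  = suc (2 * code w)

code-injective : ∀ {k} {v w : BitString k} → code v ≡ code w → v ≡ w
code-injective {v = []}        {[]}        _ = refl
code-injective {v = false ∷ v} {false ∷ w} e = cong (false ∷_) (code-injective (*-cancelˡ-≡ _ _ 2 e))
code-injective {v = true ∷ v}  {true ∷ w}  e = cong (true ∷_) (code-injective (*-cancelˡ-≡ _ _ 2 (suc-injective e)))
code-injective {v = false ∷ v} {true ∷ w}  e = ⊥-elim (even≢odd (code v) (code w) e)
code-injective {v = true ∷ v}  {false ∷ w} e = ⊥-elim (even≢odd (code w) (code v) (sym e))

len pos best : ℕ
len  = 0
pos  = 1
best = 2

-- The offset skips `len`, `pos` and `best`. Being made of literal successors, it lets updates of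
-- those registers leave the counters unchanged by computation.
cell : ∀ {k} → BitString k → ℕ
cell w = 3 + code w

-- Choices of one pattern per column

module _ {k : ℕ} where

  ones zeros : Fin k → BitString k → Bool
  ones  i w = lookup w i
  zeros i w = not (lookup w i)

  weight : Fin k → List (BitString k) → ℕ
  weight i = tally (ones i)

  occ : BitString k → List (BitString k) → ℕ
  occ u = tally (λ w → does (u ≟ᵇ w))

  occ>0⇒∈ : ∀ {u} ws → 0 < occ u ws → u ∈ ws
  occ>0⇒∈ {u} (w ∷ ws) h with u ≟ᵇ w
  ... | yes e = here e
  ... | no  _ = there (occ>0⇒∈ ws h)

  occ≡0⇒∉ : ∀ {u} ws → occ u ws ≡ 0 → ¬ u ∈ ws
  occ≡0⇒∉ {u} (w ∷ ws) e p with u ≟ᵇ w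
  occ≡0⇒∉ (w ∷ ws) e (here p)  | no ¬p = ¬p p
  occ≡0⇒∉ (w ∷ ws) e (there p) | no ¬p = occ≡0⇒∉ ws e p

  occ-head : ∀ u ws → occ u (u ∷ ws) ≡ suc (occ u ws)
  occ-head u ws with u ≟ᵇ u
  ... | yes _ = refl
  ... | no ¬e = ⊥-elim (¬e refl)

  Variant : BitString k → BitString k → Set
  Variant a w = w ≡ a ⊎ w ≡ complement a

  Choice : List (BitString k) → List (BitString k) → Set
  Choice = Pointwise Variant

  Variant-complement : ∀ {a w} → Variant a w → Variant a (complement w)
  Variant-complement (inj₁ refl) = inj₂ refl
  Variant-complement (inj₂ refl) = inj₁ (complement-involutive _)

  Variant-unique : ∀ {a w w′} → Variant a w → Variant a w′ → w′ ≡ w ⊎ w′ ≡ complement w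
  Variant-unique (inj₁ refl) v           = v
  Variant-unique (inj₂ refl) (inj₁ refl) = inj₂ (sym (complement-involutive _))
  Variant-unique (inj₂ refl) (inj₂ refl) = inj₁ refl

  -- Changing the symbol of the string at a position with pattern `u` complements that one entry.
  -- The result is given up to permutation, which is all that the counters record.
  Choice-flip : ∀ {u cols ws} → Choice cols ws → u ∈ ws → ∃[ ws′ ] ∃[ rest ]
    (ws ↭ u ∷ rest × ws′ ↭ complement u ∷ rest × Choice cols ws′)
  Choice-flip (v ∷ c) (here refl) = _ , _ , ↭-refl , ↭-refl , Variant-complement v ∷ c
  Choice-flip {ws = w ∷ _} (v ∷ c) (there p) with Choice-flip c p
  ... | ws′ , rest , q , q′ , c′ = w ∷ ws′ , w ∷ rest ,
    ↭-trans (prep w q) (swap w _ ↭-refl) , ↭-trans (prep w q′) (swap w _ ↭-refl) , v ∷ c′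

  -- If the first column holds `complement a`, it trades patterns with a later column holding `a`,
  -- for which both patterns are possible as well. This lets the second pass decide greedily from
  -- the counters.
  Choice-pull : ∀ {a cols ws} → Choice (a ∷ cols) ws → a ∈ ws →
    ∃[ rest ] (ws ↭ a ∷ rest × Choice cols rest)
  Choice-pull (inj₁ refl ∷ c) _         = _ , ↭-refl , c
  Choice-pull (inj₂ refl ∷ c) (here e)  = _ , ↭-reflexive (cong (_∷ _) (sym e)) , c
  Choice-pull (inj₂ refl ∷ c) (there p) with Choice-flip c p
  ... | ws′ , rest , q , q′ , c′ = ws′ ,
    ↭-trans (prep _ q) (↭-trans (swap _ _ ↭-refl) (prep _ (↭-sym q′))) , c′

  -- `δ` collects the entries of `ws` that are complemented in `ws′`; each of them gives up its ones
  -- and gains its zeros.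
  Choice-difference : ∀ {cols ws ws′} → Choice cols ws → Choice cols ws′ → ∃[ δ ] ∃[ same ]
    (δ ++ same ↭ ws × ∀ i → weight i ws′ + weight i δ ≡ weight i ws + tally (zeros i) δ)
  Choice-difference [] [] = [] , [] , ↭-refl , λ _ → refl
  Choice-difference {ws = w ∷ ws} {ws′ = w′ ∷ ws′} (v ∷ c) (v′ ∷ c′)
    with Choice-difference c c′ | Variant-unique v v′
  ... | δ , same , q , e | inj₁ refl = δ , w ∷ same , ↭-trans (shift w δ same) (prep w q) , λ i →
    trans (+-assoc (bit (ones i w)) _ _)
      (trans (cong (bit (ones i w) +_) (e i)) (sym (+-assoc (bit (ones i w)) _ _)))
  ... | δ , same , q , e | inj₂ refl = w ∷ δ , same , prep w q , λ i → begin
    bit (ones i (complement w)) + weight i ws′ + (bit (ones i w) + weight i δ)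
      ≡⟨ cong (λ b → bit b + weight i ws′ + (bit (ones i w) + weight i δ)) (lookup-map i not w) ⟩
    bit (zeros i w) + weight i ws′ + (bit (ones i w) + weight i δ)
      ≡⟨ l₁ (bit (zeros i w)) _ (bit (ones i w)) _ ⟩
    bit (ones i w) + bit (zeros i w) + (weight i ws′ + weight i δ)
      ≡⟨ cong (bit (ones i w) + bit (zeros i w) +_) (e i) ⟩
    bit (ones i w) + bit (zeros i w) + (weight i ws + tally (zeros i) δ)
      ≡⟨ l₂ (bit (ones i w)) (bit (zeros i w)) _ _ ⟩
    bit (ones i w) + weight i ws + (bit (zeros i w) + tally (zeros i) δ) ∎
    where
    open ≡-Reasoning
    l₁ : ∀ z a o b → z + a + (o + b) ≡ o + z + (a + b)
    l₁ = solve-∀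
    l₂ : ∀ o z a b → o + z + (a + b) ≡ o + a + (z + b)
    l₂ = solve-∀

  record Admissible (d : ℕ) (ws m : List (BitString k)) : Set where
    constructor admissible
    field
      available : All (λ u → occ u m ≤ occ u ws) m
      improving : All (λ i → weight i ws + tally (zeros i) m ≤ d + weight i m) (allFin k)

  moves : List (List (BitString k))
  moves = words (patterns k) (blockSize {A = BitString k} (allFin k) 1)

  -- Complementing an entry raises the distances at its zeros and lowers them at its ones, so
  -- `bounded-exchange` applies to the difference of the two choices. The part it selects is short
  -- enough to be listed in `moves`, and available because it is contained in `ws`.
  exchange : ∀ {cols ws ws′ d} → Choice cols ws → Choice cols ws′ →
    (∀ i → weight i ws ≤ suc d) → (∀ i → weight i ws′ ≤ d) →
    ∃[ m ] (m ∈ moves × Admissible d ws m)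
  exchange {ws = ws} {ws′} {d} c c′ ws≤ ws′≤
    with δ , same , δ↭ , e ← Choice-difference c c′
    with m , r , m↭ , sz , imp ← bounded-exchange zeros ones (λ i → weight i ws) d ws≤ (allFin k) δ
           (λ i → ≤-trans (≤-reflexive (sym (e i))) (+-monoˡ-≤ (weight i δ) (ws′≤ i)))
    = m , ∈-words ∈-patterns m sz , admissible (All.tabulate λ {u} _ → avail u) imp
    where
    open ≤-Reasoning
    avail : ∀ u → occ u m ≤ occ u ws
    avail u = begin
      occ u m               ≤⟨ m≤m+n (occ u m) _ ⟩
      occ u m + occ u r     ≡⟨ tally-++ _ m r ⟨
      occ u (m ++ r)        ≡⟨ tally-↭ _ m↭ ⟩
      occ u δ               ≤⟨ m≤m+n (occ u δ) _ ⟩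
      occ u δ + occ u same  ≡⟨ tally-++ _ δ same ⟨
      occ u (δ ++ same)     ≡⟨ tally-↭ _ δ↭ ⟩
      occ u ws              ∎

  -- Patterns outside `m` have count zero in `m`, so testing the entries of `m` is enough.
  available-everywhere : ∀ m {ws} → All (λ u → occ u m ≤ occ u ws) m → ∀ u → occ u m ≤ occ u ws
  available-everywhere m {ws} av u with occ u m in e
  ... | zero  = z≤n
  ... | suc _ = subst (_≤ occ u ws) e (All.lookup {P = λ v → occ v m ≤ occ v ws} av
    (occ>0⇒∈ {u} m (subst (0 <_) (sym e) (s≤s z≤n))))

-- The counters and the search for an admissible move

update-same : ∀ (f : ℕ → ℕ) i v → (f [ i ↦ v ]) i ≡ v
update-same f i v with i ≡ᵇ i in e
... | true  = refl
... | false = ⊥-elim (subst T e (≡⇒≡ᵇ i i refl))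

update-other : ∀ (f : ℕ → ℕ) {i j} v → i ≢ j → (f [ i ↦ v ]) j ≡ f j
update-other f {i} {j} v i≢j with i ≡ᵇ j in e
... | false = refl
... | true  = ⊥-elim (i≢j (≡ᵇ⇒≡ i j (subst T (sym e) _)))

update-cell : ∀ {k} (f : ℕ → ℕ) (u w : BitString k) v →
  (f [ cell u ↦ v ]) (cell w) ≡ (if does (w ≟ᵇ u) then v else f (cell w))
update-cell f u w v with w ≟ᵇ u
... | yes refl = update-same f (cell w) v
... | no w≢u = update-other f v λ e → w≢u (sym (code-injective (+-cancelˡ-≡ 3 _ _ e)))

sumᵗ : List Term → Term
sumᵗ []       = num 0
sumᵗ (t ∷ ts) = t ⊕ sumᵗ ts

module _ {A : Set} (f : A → Term) {s : State} where

  sumᵗ≡0⇒ : ∀ xs → ⟦ sumᵗ (map f xs) ⟧ s ≡ 0 → All (λ x → ⟦ f x ⟧ s ≡ 0) xs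
  sumᵗ≡0⇒ []       _ = []
  sumᵗ≡0⇒ (x ∷ xs) e = m+n≡0⇒m≡0 _ e ∷ sumᵗ≡0⇒ xs (m+n≡0⇒n≡0 (⟦ f x ⟧ s) e)

  sumᵗ≡0⇐ : ∀ {xs} → All (λ x → ⟦ f x ⟧ s ≡ 0) xs → ⟦ sumᵗ (map f xs) ⟧ s ≡ 0
  sumᵗ≡0⇐ []       = refl
  sumᵗ≡0⇐ (e ∷ es) = cong₂ _+_ e (sumᵗ≡0⇐ es)

  sumᵗ-value : ∀ {h : A → ℕ} xs → (∀ x → ⟦ f x ⟧ s ≡ h x) → ⟦ sumᵗ (map f xs) ⟧ s ≡ sum (map h xs)
  sumᵗ-value []       e = refl
  sumᵗ-value (x ∷ xs) e = cong₂ _+_ (e x) (sumᵗ-value xs e)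

≺≡0⇒≤ : ∀ m n → bit (m <ᵇ n) ≡ 0 → n ≤ m
≺≡0⇒≤ m n e with m <ᵇ n in q
... | false = ≮⇒≥ (λ h → subst T q (<⇒<ᵇ h))

≤⇒≺≡0 : ∀ m n → n ≤ m → bit (m <ᵇ n) ≡ 0
≤⇒≺≡0 m n h with m <ᵇ n in q
... | false = refl
... | true  = ⊥-elim (≤⇒≯ h (<ᵇ⇒< m n (subst T (sym q) _)))

module _ {A : Set} where

  sum-zero : ∀ (h : A → Bool) xs → sum (map (λ x → if h x then 0 else 0) xs) ≡ 0
  sum-zero h [] = refl
  sum-zero h (x ∷ xs) with h x
  ... | true  = sum-zero h xs
  ... | false = sum-zero h xs

  sum-if-+ : ∀ (h : A → Bool) (f g : A → ℕ) xs →
    sum (map (λ x → if h x then f x + g x else 0) xs) ≡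
    sum (map (λ x → if h x then f x else 0) xs) + sum (map (λ x → if h x then g x else 0) xs)
  sum-if-+ h f g [] = refl
  sum-if-+ h f g (x ∷ xs) with h x
  ... | false = sum-if-+ h f g xs
  ... | true  = trans (cong (f x + g x +_) (sum-if-+ h f g xs)) (lemma (f x) (g x) _ _)
    where
    lemma : ∀ a b c d → a + b + (c + d) ≡ a + c + (b + d)
    lemma = solve-∀

sum-patterns : ∀ k (f : BitString (suc k) → ℕ) → sum (map f (patterns (suc k))) ≡
  sum (map (f ∘ (false ∷_)) (patterns k)) + sum (map (f ∘ (true ∷_)) (patterns k))
sum-patterns k f = begin
  sum (map f (map (false ∷_) ps ++ map (true ∷_) ps))
    ≡⟨ cong sum (map-++ f (map (false ∷_) ps) _) ⟩
  sum (map f (map (false ∷_) ps) ++ map f (map (true ∷_) ps))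
    ≡⟨ sum-++ (map f (map (false ∷_) ps)) _ ⟩
  sum (map f (map (false ∷_) ps)) + sum (map f (map (true ∷_) ps))
    ≡⟨ cong₂ (λ xs ys → sum xs + sum ys) (map-∘ ps) (map-∘ ps) ⟨
  sum (map (f ∘ (false ∷_)) ps) + sum (map (f ∘ (true ∷_)) ps) ∎
  where
  open ≡-Reasoning
  ps = patterns k

sum-indicator : ∀ {k} (h : BitString k → Bool) u →
  sum (map (λ w → if h w then bit (does (w ≟ᵇ u)) else 0) (patterns k)) ≡ bit (h u)
sum-indicator h [] with h []
... | true  = refl
... | false = refl
sum-indicator {suc k} h (false ∷ u) = trans (sum-patterns k _)
  (trans (cong₂ _+_ (sum-indicator (h ∘ (false ∷_)) u) (sum-zero (h ∘ (true ∷_)) (patterns k))) (+-identityʳ _))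
sum-indicator {suc k} h (true ∷ u) = trans (sum-patterns k _)
  (cong₂ _+_ (sum-zero (h ∘ (false ∷_)) (patterns k)) (sum-indicator (h ∘ (true ∷_)) u))

-- Double counting: every entry of `ws` is counted by exactly one pattern.
sum-occ : ∀ {k} (h : BitString k → Bool) ws →
  sum (map (λ w → if h w then occ w ws else 0) (patterns k)) ≡ tally h ws
sum-occ {k} h []       = sum-zero h (patterns k)
sum-occ {k} h (u ∷ ws) = trans (sum-if-+ h (λ w → bit (does (w ≟ᵇ u))) (λ w → occ w ws) (patterns k))
  (cong₂ _+_ (sum-indicator h u) (sum-occ h ws))

module _ {k : ℕ} where

  record View (ℓ j d : ℕ) (ws : List (BitString k)) (M : ℕ → ℕ) (s : State) : Set where
    constructor view
    field
      at-len  : register s len ≡ ℓ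
      at-pos  : register s pos ≡ j
      at-best : register s best ≡ d
      at-cell : ∀ w → register s (cell w) ≡ occ w ws
      at-mem  : memory s ≡ M
  open View public

  view-inc : ∀ {ℓ j d ws M s} u → View ℓ j d ws M s → View ℓ j d (u ∷ ws) M (run (inc (cell u)) s)
  view-inc {ws = ws} {s = s} u (view l p b c m) = view l p b cells m
    where
    cells : ∀ w → (register s [ cell u ↦ register s (cell u) + 1 ]) (cell w) ≡ occ w (u ∷ ws)
    cells w rewrite update-cell (register s) u w (register s (cell u) + 1) with w ≟ᵇ u
    ... | yes refl = trans (+-comm _ 1) (cong suc (c w))
    ... | no _     = c w

  view-dec : ∀ {ℓ j d ws rest M s} u → ws ↭ u ∷ rest → View ℓ j d ws M s →
    View ℓ j d rest M (run (dec (cell u)) s)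
  view-dec {ws = ws} {rest} {s = s} u ↭ (view l p b c m) = view l p b cells m
    where
    cells : ∀ w → (register s [ cell u ↦ register s (cell u) ∸ 1 ]) (cell w) ≡ occ w rest
    cells w rewrite update-cell (register s) u w (register s (cell u) ∸ 1)
      with w ≟ᵇ u | trans (c w) (tally-↭ (λ v → does (w ≟ᵇ v)) ↭)
    ... | yes refl | e = cong (_∸ 1) e
    ... | no _     | e = e

  view-↭ : ∀ {ℓ j d ws ws′ M s} → ws ↭ ws′ → View ℓ j d ws M s → View ℓ j d ws′ M s
  view-↭ q (view l p b c m) = view l p b (λ w → trans (c w) (tally-↭ _ q)) m

  view-pos : ∀ {ℓ j d ws M s j′ v} → v ≡ j′ → View ℓ j d ws M s →
    View ℓ j′ d ws M (state (register s [ pos ↦ v ]) (memory s))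
  view-pos e (view l p b c m) = view l e b c m

  view-best : ∀ {ℓ j d ws M s d′ v} → v ≡ d′ → View ℓ j d ws M s →
    View ℓ j d′ ws M (state (register s [ best ↦ v ]) (memory s))
  view-best e (view l p b c m) = view l p e c m

  distance : Fin k → Term
  distance i = sumᵗ (map (λ w → if lookup w i then var (cell w) else num 0) (patterns k))

  distance-value : ∀ {ℓ j d ws M s} i → View ℓ j d ws M s → ⟦ distance i ⟧ s ≡ weight i ws
  distance-value {ws = ws} {s = s} i v = trans (sumᵗ-value _ (patterns k) val) (sum-occ (ones i) ws)
    where
    val : ∀ w → ⟦ if lookup w i then var (cell w) else num 0 ⟧ s ≡ (if lookup w i then occ w ws else 0)
    val w with lookup w i
    ... | true  = at-cell v w
    ... | false = refl

  shortage : List (BitString k) → BitString k → Term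
  shortage m u = var (cell u) ≺ num (occ u m)

  excess : List (BitString k) → Fin k → Term
  excess m i = var best ⊕ num (weight i m) ≺ distance i ⊕ num (tally (zeros i) m)

  -- A sum of 0/1 tests vanishes exactly when none of them fires, so one branch decides
  -- admissibility. The counts of `m` are literals because `m` is fixed when the code is generated.
  violations : List (BitString k) → Term
  violations m = sumᵗ (map (shortage m) m) ⊕ sumᵗ (map (excess m) (allFin k))

  swapAll : List (BitString k) → Code
  swapAll []      = nop
  swapAll (u ∷ m) = dec (cell u) ⨾ inc (cell (complement u)) ⨾ swapAll m

  search : List (List (BitString k)) → Code
  search []       = inc best
  search (m ∷ ms) = branch (violations m) (search ms) (swapAll m)

  module _ {ℓ j d ws M s} (v : View ℓ j d ws M s) where

    violations≡0⇒ : ∀ m → ⟦ violations m ⟧ s ≡ 0 → Admissible d ws m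
    violations≡0⇒ m e = admissible
      (All.map (λ {u} h → ≤-trans (≺≡0⇒≤ _ _ h) (≤-reflexive (at-cell v u)))
        (sumᵗ≡0⇒ (shortage m) m (m+n≡0⇒m≡0 _ e)))
      (All.map (λ {i} h → subst₂ (λ D b → D + _ ≤ b + _) (distance-value i v) (at-best v) (≺≡0⇒≤ _ _ h))
        (sumᵗ≡0⇒ (excess m) (allFin k) (m+n≡0⇒n≡0 (⟦ sumᵗ (map (shortage m) m) ⟧ s) e)))

    violations≡0⇐ : ∀ m → Admissible d ws m → ⟦ violations m ⟧ s ≡ 0
    violations≡0⇐ m (admissible av imp) = cong₂ _+_
      (sumᵗ≡0⇐ (shortage m)
        (All.map (λ {u} h → ≤⇒≺≡0 _ _ (≤-trans h (≤-reflexive (sym (at-cell v u))))) av))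
      (sumᵗ≡0⇐ (excess m)
        (All.map (λ {i} h → ≤⇒≺≡0 _ _ (subst₂ (λ D b → D + _ ≤ b + _)
          (sym (distance-value i v)) (sym (at-best v)) h)) imp))

  -- Each step removes `u` from the pending move and from the multiset alike, and the inserted
  -- complement only adds to a counter; hence the rest of the move stays available.
  run-swapAll : ∀ m {ℓ j d cols ws M s} → View ℓ j d ws M s → Choice cols ws →
    (∀ u → occ u m ≤ occ u ws) → ∃[ ws′ ] (View ℓ j d ws′ M (run (swapAll m) s) × Choice cols ws′ ×
      ∀ i → weight i ws′ + weight i m ≡ weight i ws + tally (zeros i) m)
  run-swapAll [] v c _ = _ , v , c , λ _ → refl
  run-swapAll (u ∷ m) {ws = ws} v c av
    with Choice-flip c (occ>0⇒∈ {u = u} ws (≤-trans (≤-trans (s≤s z≤n) (≤-reflexive (sym (occ-head u m)))) (av u)))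
  ... | ws₁ , rest , q , q₁ , c₁
    with run-swapAll m (view-↭ (↭-sym q₁) (view-inc (complement u) (view-dec u q v))) c₁ av₁
    where
    av₁ : ∀ w → occ w m ≤ occ w ws₁
    av₁ w = ≤-trans
      (+-cancelˡ-≤ (bit (does (w ≟ᵇ u))) _ _ (≤-trans (av w) (≤-reflexive (tally-↭ _ q))))
      (≤-trans (m≤n+m _ (bit (does (w ≟ᵇ complement u)))) (≤-reflexive (sym (tally-↭ _ q₁))))
  ... | ws′ , v′ , c′ , e = ws′ , v′ , c′ , λ i → begin
    weight i ws′ + (bit (ones i u) + weight i m)
      ≡⟨ l₁ (weight i ws′) (bit (ones i u)) _ ⟩
    bit (ones i u) + (weight i ws′ + weight i m)
      ≡⟨ cong (bit (ones i u) +_) (e i) ⟩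
    bit (ones i u) + (weight i ws₁ + tally (zeros i) m)
      ≡⟨ cong (λ t → bit (ones i u) + (t + tally (zeros i) m)) (tally-↭ (ones i) q₁) ⟩
    bit (ones i u) + (bit (ones i (complement u)) + weight i rest + tally (zeros i) m)
      ≡⟨ cong (λ b → bit (ones i u) + (bit b + weight i rest + tally (zeros i) m)) (lookup-map i not u) ⟩
    bit (ones i u) + (bit (zeros i u) + weight i rest + tally (zeros i) m)
      ≡⟨ l₂ (bit (ones i u)) (bit (zeros i u)) (weight i rest) _ ⟩
    bit (ones i u) + weight i rest + (bit (zeros i u) + tally (zeros i) m)
      ≡⟨ cong (_+ _) (tally-↭ (ones i) q) ⟨
    weight i ws + (bit (zeros i u) + tally (zeros i) m) ∎
    where
    open ≡-Reasoning
    l₁ : ∀ a b c → a + (b + c) ≡ b + (a + c)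
    l₁ = solve-∀
    l₂ : ∀ o z r t → o + (z + r + t) ≡ o + r + (z + t)
    l₂ = solve-∀

  run-search : ∀ ms {ℓ j d cols ws M s} → View ℓ j d ws M s → Choice cols ws →
    (∃[ ws′ ] (View ℓ j d ws′ M (run (search ms) s) × Choice cols ws′ × ∀ i → weight i ws′ ≤ d)) ⊎
    (View ℓ j (suc d) ws M (run (search ms) s) × ∀ m → m ∈ ms → ¬ Admissible d ws m)
  run-search [] v c = inj₂ (view-best (trans (+-comm _ 1) (cong suc (at-best v))) v , λ _ ())
  run-search (m ∷ ms) {d = d} {ws = ws} {s = s} v c with ⟦ violations m ⟧ s in e
  ... | zero = let ws′ , v′ , c′ , bal = run-swapAll m v c (available-everywhere m {ws} (Admissible.available ok))
               in inj₁ (ws′ , v′ , c′ , λ i → +-cancelʳ-≤ (weight i m) _ _ (≤-trans (≤-reflexive (bal i))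
                    (All.lookup (Admissible.improving ok) (∈-allFin i))))
    where
    ok : Admissible d ws m
    ok = violations≡0⇒ v m e
  ... | suc _ with run-search ms v c
  ...   | inj₁ found      = inj₁ found
  ...   | inj₂ (v′ , bad) = inj₂ (v′ , λ { _ (here refl) ok → 1+n≢0 (trans (sym e) (violations≡0⇐ v m ok))
                                         ; m′ (there p) → bad m′ p })

-- The two passes over the columns

-- Registers cannot be addressed by computed values, so the counter of a column is selected by a
-- decision tree over its `k` bits.
dispatch : ∀ k → (ℕ → Term) → (BitString k → Code) → Code
dispatch zero    t f = f []
dispatch (suc k) t f = branch (at (t 0))
  (dispatch k (t ∘ suc) (f ∘ (true ∷_))) (dispatch k (t ∘ suc) (f ∘ (false ∷_)))

run-dispatch : ∀ {k} t f {s} (a : BitString k) →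
  (∀ i → memory s (⟦ t (toℕ i) ⟧ s) ≡ bit (lookup a i)) → run (dispatch k t f) s ≡ run (f a) s
run-dispatch t f []      h = refl
run-dispatch t f (b ∷ a) h rewrite h zero with b
... | true  = run-dispatch (t ∘ suc) (f ∘ (true ∷_)) a (h ∘ suc)
... | false = run-dispatch (t ∘ suc) (f ∘ (false ∷_)) a (h ∘ suc)

-- The address `i * ℓ + pos` by repeated addition, as `Term` has no product; `row k` is the output
-- address.
row : ℕ → Term
row zero    = var pos
row (suc i) = var len ⊕ row i

row-value : ∀ i s → ⟦ row i ⟧ s ≡ i * register s len + register s pos
row-value zero    s = refl
row-value (suc i) s = trans (cong (register s len +_) (row-value i s)) (sym (+-assoc (register s len) _ _))

module _ {k : ℕ} where

  mask : Bool → BitString k → BitString k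
  mask b a = if b then complement a else a

  Solved : ℕ → List (BitString k) → List (BitString k) → Set
  Solved d cols ws = Choice cols ws × (∀ i → weight i ws ≤ d) ×
    (∀ {ws′ e} → Choice cols ws′ → (∀ i → weight i ws′ ≤ e) → d ≤ e)

  countColumn : Code
  countColumn = dec pos ⨾ dispatch k row (λ a → inc (cell a)) ⨾ search (moves {k})

  emit : BitString k → Bool → Code
  emit a b = dec (cell (mask b a)) ⨾ put (row k) b

  -- Symbol 0 realises the pattern `a` and symbol 1 its complement; the counter of `a` tells whether
  -- `a` is still to be used.
  emitAny : BitString k → Code
  emitAny a = branch (var (cell a)) (emit a false) (emit a true)

  writeSymbol : Code
  writeSymbol = dispatch k row emitAny ⨾ inc pos

  Stored : ℕ → (ℕ → BitString k) → (ℕ → ℕ) → Set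
  Stored ℓ col M = ∀ i {j} → j < ℓ → M (toℕ i * ℓ + j) ≡ bit (lookup (col j) i)

  -- If the search succeeds, `d` is still a lower bound, since dropping the new column from a choice
  -- raises no distance. If it fails, keeping `a` uncomplemented attains `suc d`, and a choice
  -- attaining `d` would yield an admissible move by `exchange`.
  search-solves : ∀ {ℓ j d a cols ws M s} → View ℓ j d (a ∷ ws) M s → Solved d cols ws →
    ∃[ ws′ ] ∃[ d′ ] (View ℓ j d′ ws′ M (run (search (moves {k})) s) × Solved d′ (a ∷ cols) ws′)
  search-solves {d = d} {a} {cols} {ws} v (c , ws≤ , low) with run-search (moves {k}) v (inj₁ refl ∷ c)
  ... | inj₁ (ws′ , v′ , c′ , ws′≤) = ws′ , d , v′ , c′ , ws′≤ , λ
    { {w ∷ _} (_ ∷ c″) h → low c″ (λ i → ≤-trans (m≤n+m _ (bit (ones i w))) (h i)) }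
  ... | inj₂ (v′ , bad) = a ∷ ws , suc d , v′ , inj₁ refl ∷ c , a∷ws≤ , λ
    { {w ∷ _} (u ∷ c″) h → ≤∧≢⇒< (low c″ (λ i → ≤-trans (m≤n+m _ (bit (ones i w))) (h i)))
        λ { refl → let m , m∈ , ok = exchange (inj₁ refl ∷ c) (u ∷ c″) a∷ws≤ h in bad m m∈ ok } }
    where
    a∷ws≤ : ∀ i → weight i (a ∷ ws) ≤ suc d
    a∷ws≤ i = +-mono-≤ (bit≤1 (ones i a)) (ws≤ i)

  module _ (col : ℕ → BitString k) where

    columns : ℕ → ℕ → List (BitString k)
    columns zero    j = []
    columns (suc n) j = col j ∷ columns n (suc j)

    masked : ∀ {n} → BitString n → ℕ → List (BitString k)
    masked []      j = []
    masked (b ∷ x) j = mask b (col j) ∷ masked x (suc j)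

    Choice-masked : ∀ {n} (x : BitString n) j → Choice (columns n j) (masked x j)
    Choice-masked []          j = []
    Choice-masked (false ∷ x) j = inj₁ refl ∷ Choice-masked x (suc j)
    Choice-masked (true ∷ x)  j = inj₂ refl ∷ Choice-masked x (suc j)

  module _ {ℓ : ℕ} (col : ℕ → BitString k) where

    run-column : ∀ {j d M s} {ws : List (BitString k)} f → View ℓ j d ws M s → Stored ℓ col M → j < ℓ →
      run (dispatch k row f) s ≡ run (f (col j)) s
    run-column {s = s} f (view refl refl _ _ refl) st j<ℓ = run-dispatch row f (col _)
      λ i → trans (cong (memory s) (row-value (toℕ i) s)) (st i j<ℓ)

    -- Columns are consumed from the last to the first, so `columns` grows at its front and `pos`
    -- ends at 0, where the second pass starts.
    count-phase : ∀ j {n d ws M s} → j + n ≡ ℓ → Stored ℓ col M → View ℓ j d ws M s →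
      Solved d (columns col n j) ws → ∃[ s′ ] ∃[ ws′ ] ∃[ d′ ]
        (Runs (var pos) countColumn j s s′ × View ℓ 0 d′ ws′ M s′ × Solved d′ (columns col ℓ 0) ws′)
    count-phase zero refl st v sol = _ , _ , _ , stop (at-pos v) , v , sol
    count-phase (suc j) {n} {s = s} e st v sol
      with search-solves
             (subst (View _ _ _ _ _) (sym (run-column (λ a → inc (cell a)) v₁ st j<ℓ)) (view-inc (col j) v₁)) sol
      where
      v₁ = view-pos (cong (_∸ 1) (at-pos v)) v
      j<ℓ : j < ℓ
      j<ℓ = ≤-trans (m≤m+n (suc j) n) (≤-reflexive e)
    ... | ws′ , d′ , v′ , sol′ with count-phase j (trans (+-suc j n) e) st v′ sol′
    ... | s″ , ws″ , d″ , r , v″ , sol″ =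
      s″ , ws″ , d″ , step (λ z → 1+n≢0 (trans (sym (at-pos v)) z)) r , v″ , sol″

    emit-view : ∀ {j d ws rest M s} a b → ws ↭ mask b a ∷ rest → View ℓ j d ws M s →
      View ℓ (suc j) d rest (M [ k * ℓ + j ↦ bit b ]) (run (emit a b ⨾ inc pos) s)
    emit-view {s = s} a b q v with view-dec (mask b a) q v
    ... | view refl refl e c refl = view refl (+-comm _ 1) e c
      (cong (λ i → memory s [ i ↦ bit b ]) (row-value k (run (dec (cell (mask b a))) s)))

    Written : ℕ → ℕ → List (BitString k) → List (BitString k) → (ℕ → ℕ) → BitString k → State → Set
    Written j d cols ws M a s = ∃[ b ] ∃[ rest ] (Choice cols rest × mask b a ∷ rest ↭ ws ×
      View ℓ (suc j) d rest (M [ k * ℓ + j ↦ bit b ]) s)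

    write-step : ∀ {j d cols ws M s} a → Choice (a ∷ cols) ws → View ℓ j d ws M s →
      Written j d cols ws M a (run (emitAny a ⨾ inc pos) s)
    write-step {cols = cols} {ws} {s = s} a c v = go (register s (cell a)) refl c
      where
      run-choice : ∀ {n} → register s (cell a) ≡ n →
        run (emitAny a ⨾ inc pos) s ≡
        run (inc pos) (choose n (run (emit a false) s) (run (emit a true) s))
      run-choice refl = refl
      go : ∀ n → register s (cell a) ≡ n → Choice (a ∷ cols) ws →
        Written _ _ cols ws _ a (run (emitAny a ⨾ inc pos) s)
      go (suc n) e c =
        let rest , q , c′ = Choice-pull c (occ>0⇒∈ {u = a} ws
              (≤-trans (s≤s z≤n) (≤-reflexive (trans (sym e) (at-cell v a)))))
        in false , rest , c′ , ↭-sym q , subst (View _ _ _ _ _) (sym (run-choice e)) (emit-view a false q v)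
      -- With the counter of `a` at zero, the first column must hold the complement.
      go zero e (inj₁ w≡a ∷ _) = ⊥-elim (occ≡0⇒∉ ws (trans (sym (at-cell v a)) e) (here (sym w≡a)))
      go zero e (inj₂ refl ∷ c) =
        true , _ , c , ↭-refl , subst (View _ _ _ _ _) (sym (run-choice e)) (emit-view a true ↭-refl v)

    -- The output starts at `k * ℓ`, above all input addresses.
    Stored-output : ∀ {M j v} → Stored ℓ col M → Stored ℓ col (M [ k * ℓ + j ↦ v ])
    Stored-output {M} {j} {v} st i {j′} j′<ℓ = trans (update-other M v λ e → <⇒≢ below (sym e)) (st i j′<ℓ)
      where
      open ≤-Reasoning
      below : toℕ i * ℓ + j′ < k * ℓ + j
      below = begin-strict
        toℕ i * ℓ + j′   <⟨ +-monoʳ-< (toℕ i * ℓ) j′<ℓ ⟩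
        toℕ i * ℓ + ℓ    ≡⟨ +-comm _ ℓ ⟩
        suc (toℕ i) * ℓ  ≤⟨ *-monoˡ-≤ ℓ (toℕ<n i) ⟩
        k * ℓ            ≤⟨ m≤m+n _ j ⟩
        k * ℓ + j        ∎

    -- The last clause protects the symbols already written from the remaining iterations. The
    -- permutation is enough for optimality, because distances depend only on the multiset.
    write-phase : ∀ n {j d ws M s} → j + n ≡ ℓ → Stored ℓ col M → View ℓ j d ws M s →
      Choice (columns col n j) ws → ∃[ s′ ] ∃[ x ]
        (Runs (var pos ≺ var len) writeSymbol n s s′ × masked col {n} x j ↭ ws × register s′ best ≡ d ×
         (∀ p → memory s′ (k * ℓ + (j + toℕ p)) ≡ bit (lookup x p)) ×
         (∀ a → a < k * ℓ + j → memory s′ a ≡ M a))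
    write-phase zero {s = s} e st v@(view refl refl _ _ refl) [] = s , [] ,
      stop (≤⇒≺≡0 _ _ (≤-reflexive (trans (sym e) (+-identityʳ _)))) , ↭-refl , at-best v , (λ ()) , λ _ _ → refl
    write-phase (suc n) {j} {d} {M = M} {s} e st v c
      with write-step (col j) c v
    ... | b , rest , c′ , q , v′
      with write-phase n (trans (sym (+-suc j n)) e) (Stored-output {M} st)
             (subst (View _ _ _ _ _) (cong (run (inc pos)) (sym (run-column emitAny v st j<ℓ))) v′) c′
      where
      j<ℓ : j < ℓ
      j<ℓ = ≤-trans (s≤s (m≤m+n j n)) (≤-reflexive (trans (sym (+-suc j n)) e))
    ... | s′ , x , r , q′ , bst , out , old = s′ , b ∷ x , step guard r , ↭-trans (prep _ q′) q , bst , out′ , old′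
      where
      guard : ⟦ var pos ≺ var len ⟧ s ≢ 0
      guard z = <⇒≱ {j} (subst₂ _<_ (+-identityʳ j) e (+-monoʳ-< j (s≤s {n = n} z≤n)))
        (subst₂ _≤_ (at-len v) (at-pos v) (≺≡0⇒≤ _ _ z))
      kℓ+j< : k * ℓ + j < k * ℓ + suc j
      kℓ+j< = +-monoʳ-< (k * ℓ) ≤-refl
      out′ : ∀ p → memory s′ (k * ℓ + (j + toℕ p)) ≡ bit (lookup (b ∷ x) p)
      out′ zero rewrite +-identityʳ j = trans (old _ kℓ+j<) (update-same M _ _)
      out′ (suc p) = trans (cong (λ i → memory s′ (k * ℓ + i)) (+-suc j (toℕ p))) (out p)
      old′ : ∀ a → a < k * ℓ + j → memory s′ a ≡ M a
      old′ a h = trans (old a (<-trans h kℓ+j<)) (update-other M _ (λ e → <⇒≢ h (sym e)))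

-- Input strings and distances

maxDistance-≥ : ∀ {k ℓ} (x : BitString ℓ) (as : Vec (BitString ℓ) k) i →
  hamming x (lookup as i) ≤ maxDistance x as
maxDistance-≥ x (a ∷ as) zero    = m≤m⊔n (hamming x a) _
maxDistance-≥ x (a ∷ as) (suc i) = ≤-trans (maxDistance-≥ x as i) (m≤n⊔m (hamming x a) _)

maxDistance-≤ : ∀ {k ℓ e} (x : BitString ℓ) (as : Vec (BitString ℓ) k) →
  (∀ i → hamming x (lookup as i) ≤ e) → maxDistance x as ≤ e
maxDistance-≤ x []       h = z≤n
maxDistance-≤ x (a ∷ as) h = ⊔-lub (h zero) (maxDistance-≤ x as (λ i → h (suc i)))

-- The default `false` makes `column` total on `ℕ`; only positions below `ℓ` are ever consulted.
nth : ∀ {n} → BitString n → ℕ → Bool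
nth []      _       = false
nth (b ∷ x) zero    = b
nth (b ∷ x) (suc j) = nth x j

lookup≡nth : ∀ {n} (x : BitString n) p → lookup x p ≡ nth x (toℕ p)
lookup≡nth (b ∷ x) zero    = refl
lookup≡nth (b ∷ x) (suc p) = lookup≡nth x p

contents≤1 : ∀ bs a → contents bs a ≤ 1
contents≤1 []       a       = z≤n
contents≤1 (b ∷ bs) zero    = bit≤1 b
contents≤1 (b ∷ bs) (suc a) = contents≤1 bs a

contents-++ˡ : ∀ {m n} (x : BitString m) (y : BitString n) {j} → j < m →
  contents (Vec.toList (x Vec.++ y)) j ≡ bit (nth x j)
contents-++ˡ (b ∷ x) y {zero}  _       = refl
contents-++ˡ (b ∷ x) y {suc j} (s≤s h) = contents-++ˡ x y h

contents-++ʳ : ∀ {m n} (x : BitString m) (y : BitString n) j →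
  contents (Vec.toList (x Vec.++ y)) (m + j) ≡ contents (Vec.toList y) j
contents-++ʳ []      y j = refl
contents-++ʳ (b ∷ x) y j = contents-++ʳ x y j

contents-concat : ∀ {k ℓ} (as : Vec (BitString ℓ) k) i {j} → j < ℓ →
  contents (Vec.toList (Vec.concat as)) (toℕ i * ℓ + j) ≡ bit (nth (lookup as i) j)
contents-concat (a ∷ as) zero    h = contents-++ˡ a _ h
contents-concat {ℓ = ℓ} (a ∷ as) (suc i) {j} h =
  trans (cong (contents (Vec.toList (a Vec.++ Vec.concat as))) (+-assoc ℓ (toℕ i * ℓ) j))
    (trans (contents-++ʳ a _ (toℕ i * ℓ + j)) (contents-concat as i h))

-- By induction on positions: `x` differs from string `i` exactly where bit `i` of the column,
-- masked by the symbol of `x`, is one.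
hamming≡weight : ∀ {k n} (col : ℕ → BitString k) (x a : BitString n) i j →
  (∀ p → lookup (col (j + toℕ p)) i ≡ lookup a p) → hamming x a ≡ weight i (masked col x j)
hamming≡weight col []      []      i j h = refl
hamming≡weight col (b ∷ x) (c ∷ a) i j h = trans (head b c) (cong₂ _+_ (sym (masked-bit b))
  (hamming≡weight col x a i (suc j)
    (λ p → trans (cong (λ q → lookup (col q) i) (sym (+-suc j (toℕ p)))) (h (suc p)))))
  where
  differ : Bool → Bool → Bool
  differ false c = c
  differ true  c = not c
  head : ∀ b c → hamming (b ∷ x) (c ∷ a) ≡ bit (differ b c) + hamming x a
  head false false = refl
  head false true  = refl
  head true  false = refl
  head true  true  = refl
  at-j : lookup (col j) i ≡ c
  at-j = trans (cong (λ q → lookup (col q) i) (sym (+-identityʳ j))) (h zero)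
  masked-bit : ∀ b → bit (lookup (mask b (col j)) i) ≡ bit (differ b c)
  masked-bit false = cong bit at-j
  masked-bit true  = cong bit (trans (lookup-map i not (col j)) (cong not at-j))

module _ {k ℓ : ℕ} (as : Vec (BitString ℓ) k) where

  column : ℕ → BitString k
  column j = Vec.map (λ a → nth a j) as

  lookup-column : ∀ j i → lookup (column j) i ≡ nth (lookup as i) j
  lookup-column j i = lookup-map i _ as

  Stored-input : Stored ℓ column (memory (input as))
  Stored-input i {j} h = trans (contents-concat as i h) (cong bit (sym (lookup-column j i)))

  hamming-column : ∀ x i → hamming x (lookup as i) ≡ weight i (masked column x 0)
  hamming-column x i = hamming≡weight column x (lookup as i) i 0
    λ p → trans (lookup-column (toℕ p) i) (sym (lookup≡nth (lookup as i) p))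

  Solved⇒IsConsensus : ∀ {d ws} x → Solved d (columns column ℓ 0) ws →
    (∀ i → weight i (masked column x 0) ≡ weight i ws) → IsConsensus as d x
  Solved⇒IsConsensus {d} x (c , ws≤ , low) e = ≤-antisym
    (maxDistance-≤ x as λ i → ≤-trans (≤-reflexive (trans (hamming-column x i) (e i))) (ws≤ i))
    (minimal x) , minimal
    where
    minimal : ∀ y → d ≤ maxDistance y as
    minimal y = low (Choice-masked column y 0) λ i →
      ≤-trans (≤-reflexive (sym (hamming-column y i))) (maxDistance-≥ y as i)

  -- The successor keeps the bound positive when `ℓ` is 0, as the bounds on code require.
  input-bounded : Bounded (suc ℓ) (input as)
  input-bounded = bounded regs (λ a → ≤-trans (contents≤1 (Vec.toList (Vec.concat as)) a) (s≤s z≤n))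
    where
    regs : ∀ r → register (input as) r ≤ suc ℓ
    regs zero    = n≤1+n ℓ
    regs (suc r) = z≤n

-- Time and word size of the whole program

exec-twoLoops : ∀ {g₁ c₁ g₂ c₂ K ℓ s₀ s₁ s₂} →
  suc (costᵗ g₁ + cost c₁) ≤ K → suc (costᵗ g₂ + cost c₂) ≤ K → Bounded (suc ℓ) s₀ →
  Runs g₁ c₁ ℓ (run (copy pos len) s₀) s₁ → Runs g₂ c₂ ℓ s₁ s₂ →
  ∃[ t ] (Exec (K * (1 + K + K) * suc ℓ)
    (compile (copy pos len) ︔ while ⌜ g₁ ⌝ (compile c₁) ︔ while ⌜ g₂ ⌝ (compile c₂) ︔ compile (copy len best))
    s₀ t (run (copy len best) s₂) × t ≤ (K + K + K + K) * suc ℓ)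
exec-twoLoops {g₁} {c₁} {K = K} {ℓ} {s₀} {s₁} {s₂} k₁ k₂ β₀ r₁ r₂ =
  -- All states stay below `(1 + K + K) * suc ℓ`, and a further factor `K` covers the evaluation of
  -- terms. Each of the four statements takes time at most `K * suc ℓ`.
  let _ , x₀ , h₀ = exec-run (copy pos len) β₀ (s≤s z≤n)
        (word 2≤K (+-monoʳ-≤ (suc ℓ) (≤-trans 2≤K (≤-trans K≤ (m≤m+n _ _)))))
      _ , x₁ , h₁ = exec-while r₁ k₁ β₁ (s≤s z≤n)
        (word (≤-refl {K}) (≤-trans (≤-reflexive (+-assoc (suc ℓ) K _)) (+-monoʳ-≤ (suc ℓ) (+-monoˡ-≤ _ K≤))))
      _ , x₂ , h₂ = exec-while r₂ k₂ β₂ (s≤s z≤n) (word (≤-refl {K}) (≤-reflexive (l₂ ℓ K)))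
      _ , x₃ , h₃ = exec-run (copy len best) β₃ (s≤s z≤n)
        (word 2≤K (≤-trans (+-monoʳ-≤ (suc ℓ + K + ℓ * K + ℓ * K) 2≤K) (≤-reflexive (l₃ ℓ K))))
  in _ , exec-︔ x₀ (exec-︔ x₁ (exec-︔ x₂ x₃)) ,
     ≤-trans (+-mono-≤ (≤-trans h₀ 2≤Kℓ) (+-mono-≤ h₁ (+-mono-≤ h₂ (≤-trans h₃ 2≤Kℓ)))) (≤-reflexive (l₄ ℓ K))
  where
  2≤K : 2 ≤ K
  2≤K = ≤-trans (s≤s (≤-trans (1≤costᵗ g₁) (m≤m+n _ (cost c₁)))) k₁
    where
    1≤costᵗ : ∀ t → 1 ≤ costᵗ t
    1≤costᵗ (num _) = s≤s z≤n
    1≤costᵗ (var _) = s≤s z≤n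
    1≤costᵗ (at _)  = s≤s z≤n
    1≤costᵗ (_ ⊕ _) = s≤s z≤n
    1≤costᵗ (_ ≺ _) = s≤s z≤n
  K≤ : K ≤ suc ℓ * K
  K≤ = m≤m+n K (ℓ * K)
  2≤Kℓ : 2 ≤ suc ℓ * K
  2≤Kℓ = ≤-trans 2≤K K≤
  l₁ : ∀ ℓ K → K * (suc ℓ + (suc ℓ * K + suc ℓ * K)) ≡ K * (1 + K + K) * suc ℓ
  l₁ = solve-∀
  l₂ : ∀ ℓ K → suc ℓ + K + ℓ * K + suc ℓ * K ≡ suc ℓ + (suc ℓ * K + suc ℓ * K)
  l₂ = solve-∀
  l₃ : ∀ ℓ K → suc ℓ + K + ℓ * K + ℓ * K + K ≡ suc ℓ + (suc ℓ * K + suc ℓ * K)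
  l₃ = solve-∀
  l₄ : ∀ ℓ K → suc ℓ * K + (suc ℓ * K + (suc ℓ * K + suc ℓ * K)) ≡ (K + K + K + K) * suc ℓ
  l₄ = solve-∀
  word : ∀ {m V} → m ≤ K → V ≤ suc ℓ + (suc ℓ * K + suc ℓ * K) → m * V ≤ K * (1 + K + K) * suc ℓ
  word p q = ≤-trans (*-mono-≤ p q) (≤-reflexive (l₁ ℓ K))
  cost≤ : ∀ a {c} → suc (a + c) ≤ K → c ≤ K
  cost≤ a h = ≤-trans (m≤n+m _ (suc a)) h
  β₁ : Bounded (suc ℓ + K) (run (copy pos len) s₀)
  β₁ = Bounded-mono (+-monoʳ-≤ (suc ℓ) 2≤K) (run-bounded (copy pos len) β₀ (s≤s z≤n))
  β₂ : Bounded (suc ℓ + K + ℓ * K) s₁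
  β₂ = Runs-bounded r₁ (cost≤ (costᵗ g₁) k₁) β₁ (s≤s z≤n)
  β₃ : Bounded (suc ℓ + K + ℓ * K + ℓ * K) s₂
  β₃ = Runs-bounded r₂ (cost≤ (costᵗ _) k₂) β₂ (s≤s z≤n)

consensusProgram : ℕ → Program
consensusProgram k =
  compile (copy pos len) ︔
  while ⌜ var pos ⌝ (compile (countColumn {k})) ︔
  while ⌜ var pos ≺ var len ⌝ (compile (writeSymbol {k})) ︔
  compile (copy len best)

-- The guards `var pos` and `var pos ≺ var len` have cost 1 and 3; one more unit for the loop test
-- gives the constants 2 and 4.
consensus-linear : ∀ {k K} → 2 + cost (countColumn {k}) ≤ K → 4 + cost (writeSymbol {k}) ≤ K →
  ∀ ℓ (as : Vec (BitString ℓ) k) → ∃[ t ] ∃[ s ] ∃[ d ] ∃[ x ]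
    ( Exec (K * (1 + K + K) * suc ℓ) (consensusProgram k) (input as) t s
    × t ≤ (K + K + K + K) * suc ℓ
    × Output {ℓ} k s d x
    × IsConsensus as d x )
consensus-linear {k} count≤ write≤ ℓ as =
  -- Before any column is read, the zeroed registers represent the empty multiset with optimum 0.
  let s₁ , ws , d , runs₁ , v₁ , sol = count-phase (column as) ℓ {s = run (copy pos len) (input as)}
        (+-identityʳ ℓ) (Stored-input as) (view refl refl refl (λ _ → refl) refl)
        ([] , (λ _ → z≤n) , λ _ _ → z≤n)
      s₂ , x , runs₂ , x↭ , best≡ , out , _ =
        write-phase (column as) ℓ refl (Stored-input as) v₁ (proj₁ sol)
      t , exec , t≤ = exec-twoLoops count≤ write≤ (input-bounded as) runs₁ runs₂
  in t , run (copy len best) s₂ , d , x , exec , t≤ , (best≡ , out) ,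
     Solved⇒IsConsensus as x sol (λ i → tally-↭ (ones i) x↭)

-- K stays a variable because normalising its value is infeasible.
consensus-within : ∀ {k K} → 2 + cost (countColumn {k}) ≤ K → 4 + cost (writeSymbol {k}) ≤ K →
  ∃[ p ] ∃[ B ] ∃[ T ] ∀ ℓ (as : Vec (BitString ℓ) k) → ∃[ t ] ∃[ s ] ∃[ d ] ∃[ x ]
    ( Exec (B * suc ℓ) p (input as) t s × t ≤ T * suc ℓ × Output {ℓ} k s d x × IsConsensus as d x )
consensus-within {k} {K} count≤ write≤ =
  consensusProgram k , K * (1 + K + K) , K + K + K + K , consensus-linear count≤ write≤

consensus : ∀ k → ∃[ p ] ∃[ B ] ∃[ T ] ∀ ℓ (as : Vec (BitString ℓ) k) → ∃[ t ] ∃[ s ] ∃[ d ] ∃[ x ]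
  ( Exec (B * suc ℓ) p (input as) t s × t ≤ T * suc ℓ × Output {ℓ} k s d x × IsConsensus as d x )
consensus k = consensus-within
  (≤-trans (+-monoˡ-≤ count (s≤s (s≤s (z≤n {2})))) (+-monoʳ-≤ 4 (m≤m+n count write)))
  (+-monoʳ-≤ 4 (m≤n+m write count))
  where
  count = cost (countColumn {k})
  write = cost (writeSymbol {k})

mainTheorem2 : ∃[ p ] ∃[ B ] ∃[ T ] ∀ (ℓ : ℕ) (as : Vec (BitString ℓ) 5) →
    ∃[ t ] ∃[ s ] ∃[ d ] ∃[ x ]
    ( Exec (B * suc ℓ) p (input as) t s
    × t ≤ T * suc ℓ
    × Output {ℓ} 5 s d x
    × IsConsensus as d x )
mainTheorem2 = consensus 5
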